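{- Let $G$ be a graph with $n$ vertices, and let $b,a,n',m,\Delta$ be non-negative integers with $b-\Delta\ge a\ge 2$, $\delta(G)\ge\frac{b(b-\Delta)}{\Delta+a}+m+n'$ and $n>\frac{(b+a+2m-2)(a+b)}{\Delta+a}+n'$. Let $g,f$ be integer-valued functions on $V(G)$ with $b-\Delta\ge f(x)-\Delta\ge g(x)\ge a$ for every vertex $x$. If $\sigma_2(G)\ge\frac{2(n(b-\Delta)+n'(\Delta+a))}{b+a}$, then $G$ is fractional $(g,f,n',m)$-critical deleted.
   Context: All graphs are finite and simple; $\delta(G)$ is the minimum degree and $\sigma_2(G)=\min\{d_G(u)+d_G(v): u\ne v,\ uv\notin E(G)\}$. For integer-valued functions $g\le f$ on $V(G)$, a fractional $(g,f)$-factor of $G$ is a function $h:E(G)\to[0,1]$ such that $g(x)\le\sum_{e\ni x}h(e)\le f(x)$ for every vertex $x$. $G$ is fractional $(g,f,m)$-deleted if for every $H\subseteq E(G)$ with $|H|=m$, $G-H$ has a fractional $(g,f)$-factor. $G$ is fractional $(g,f,n',m)$-critical deleted if for every $U\subseteq V(G)$ with $|U|=n'$, $G-U$ is fractional $(g,f,m)$-deleted (with $g,f$ restricted to $V(G)\setminus U$). -}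

module Defs where

open import Data.Nat using (ℕ; zero; suc; _+_; _*_; _∸_; _≤_; _<_; _<ᵇ_)
open import Data.Bool using (Bool; true; false; _∧_; not; if_then_else_)
open import Data.Fin using (Fin; toℕ) renaming (zero to fzero; suc to fsuc)
open import Data.Fin.Subset using (Subset; ∣_∣)
open import Data.Vec using (lookup)
open import Data.Integer using (+_)
open import Data.Rational using (ℚ; 0ℚ; 1ℚ) renaming (_+_ to _+ℚ_; _≤_ to _≤ℚ_; _/_ to _/ℚ_)
open import Data.Product using (Σ; _×_)
open import Relation.Binary.PropositionalEquality using (_≡_)

record Graph (n : ℕ) : Set where
  field
    adj    : Fin n → Fin n → Bool
    sym    : ∀ x y → adj x y ≡ adj y x
    irrefl : ∀ x → adj x x ≡ false
open Graph public

count : ∀ {n} → (Fin n → Bool) → ℕ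
count {zero}  p = 0
count {suc n} p = (if p fzero then 1 else 0) + count (λ i → p (fsuc i))

sumℚ : ∀ {n} → (Fin n → ℚ) → ℚ
sumℚ {zero}  h = 0ℚ
sumℚ {suc n} h = h fzero +ℚ sumℚ (λ i → h (fsuc i))

ℕtoℚ : ℕ → ℚ
ℕtoℚ k = + k /ℚ 1

deg : ∀ {n} → Graph n → Fin n → ℕ
deg G x = count (adj G x)

-- A spanning subgraph-with-vertex-set given by a vertex predicate V and an
-- edge predicate E (E symmetric, only between vertices of V).
-- Fractional (g,f)-factor: h : E → [0,1] with g x ≤ Σ_{e ∋ x} h(e) ≤ f x for x ∈ V.
-- Edges are unordered: h is given on ordered pairs and required symmetric on E.
HasFractionalFactor : ∀ {n} → (V : Fin n → Bool) → (E : Fin n → Fin n → Bool)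
                    → (g f : Fin n → ℕ) → Set
HasFractionalFactor {n} V E g f =
  Σ (Fin n → Fin n → ℚ) λ h →
      (∀ x y → E x y ≡ true → h x y ≡ h y x)
    × (∀ x y → E x y ≡ true → (0ℚ ≤ℚ h x y) × (h x y ≤ℚ 1ℚ))
    × (∀ x → V x ≡ true →
          (ℕtoℚ (g x) ≤ℚ sumℚ (λ y → if E x y then h x y else 0ℚ))
        × (sumℚ (λ y → if E x y then h x y else 0ℚ) ≤ℚ ℕtoℚ (f x)))

outside : ∀ {n} → Subset n → Fin n → Bool
outside U x = not (lookup U x)

edgesMinus : ∀ {n} → Graph n → Subset n → Fin n → Fin n → Bool
edgesMinus G U x y = adj G x y ∧ outside U x ∧ outside U y

sumℕ : ∀ {n} → (Fin n → ℕ) → ℕ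
sumℕ {zero}  h = 0
sumℕ {suc n} h = h fzero + sumℕ (λ i → h (fsuc i))

edgeCount : ∀ {n} → (Fin n → Fin n → Bool) → ℕ
edgeCount H = sumℕ (λ x → count (λ y → H x y ∧ (toℕ x <ᵇ toℕ y)))

FractionalDeleted : ∀ {n} → (V : Fin n → Bool) → (E : Fin n → Fin n → Bool)
                  → (g f : Fin n → ℕ) → ℕ → Set
FractionalDeleted {n} V E g f m =
  (H : Fin n → Fin n → Bool) →
  (∀ x y → H x y ≡ H y x) →
  (∀ x y → H x y ≡ true → E x y ≡ true) →
  edgeCount H ≡ m →
  HasFractionalFactor V (λ x y → E x y ∧ not (H x y)) g f

FractionalCriticalDeleted : ∀ {n} → Graph n → (g f : Fin n → ℕ) → (n' m : ℕ) → Set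
FractionalCriticalDeleted {n} G g f n' m =
  (U : Subset n) → ∣ U ∣ ≡ n' →
  FractionalDeleted (outside U) (edgesMinus G U) g f m

{-# OPTIONS --safe #-}

-- By Hoffman's circulation theorem on the bipartite double cover, G − U − H either has a half-integral
-- (g,f)-factor or contains disjoint sets S, T with f(S) + Σ_T d < g(T), where d is the degree in
-- G − U − H − S and d < g on T.  In the second case write B = b − Δ, c = Δ + a, s = |S|, t = |T|,
-- q(x) = d(x) + d_H(x), D = Σ_T d and Q = Σ_T q ≤ D + 2m; then s c + D < B t.
-- Averaging the minimum degree condition over T gives b < t and Q < B t.  Hence a vertex u of T with
-- minimal q has a non-neighbour in T (otherwise q(u) ≥ t − 1 ≥ B); let v be one with minimal q, and
-- P = q(u) + q(v).  The conditions on σ₂ and n become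
--   2D + 2 ≤ P (a + b)   and   2D + 2 + 2B (a + b − 2 + 2m) < 2B t + c P,
-- while Q ≥ q(u) k + q(v) (t − k), where k ≤ q(u) + 1 counts the closed neighbourhood of u in T.
-- If P t ≤ 2Q these are incompatible (P ≤ 1 being treated apart); otherwise t < 2k, so
-- t ≤ 2q(u) + 1, which contradicts the second inequality.
module Submission where

open import Defs renaming (sym to adj-sym; irrefl to adj-irrefl)
open import Data.Nat as ℕ using (ℕ; zero; suc; _+_; _*_; _∸_; _≤_; _<_; _<ᵇ_; z≤n; s≤s; z<s)
import Data.Nat.Properties as ℕ
open import Data.Nat.ListAction using (sum)
open import Data.Nat.Tactic.RingSolver using (solve-∀)
open import Data.Integer as ℤ using (ℤ; +_; 0ℤ; 1ℤ; -_; _-_; +≤+) renaming (_+_ to _+ℤ_; _≤_ to _≤ℤ_; _<_ to _<ℤ_)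
import Data.Integer.Properties as ℤ
open import Data.Integer.Tactic.RingSolver using () renaming (solve-∀ to solveℤ-∀)
open import Data.Rational as ℚ using (ℚ; 0ℚ; 1ℚ; toℚᵘ)
import Data.Rational.Properties as ℚ
open import Data.Rational.Unnormalised as ℚᵘ using (mkℚᵘ; *≡*; *≤*)
import Data.Rational.Unnormalised.Properties as ℚᵘ
open import Data.Bool using (Bool; true; false; _∧_; _∨_; not; if_then_else_)
open import Data.Bool.Properties using (∧-comm)
open import Data.Fin using (Fin; toℕ; _↑ˡ_; _↑ʳ_; splitAt) renaming (zero to fzero; suc to fsuc)
import Data.Fin.Properties as Fin
open import Data.Fin.Subset using (Subset; ∣_∣)
open import Data.Vec using ([]; _∷_; lookup)
open import Data.List using (List; []; _∷_; _++_; concat; map; tabulate)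
open import Data.List.Relation.Binary.Sublist.Propositional using (_⊆_; []; _∷_; _∷ʳ_)
open import Data.Product using (_×_; _,_; ∃; ∃₂; proj₁; proj₂)
open import Data.Sum using (_⊎_; inj₁; inj₂; [_,_]′)
open import Function using (id; _∘_)
open import Data.Empty using (⊥; ⊥-elim)
open import Relation.Nullary using (¬_; Dec; yes; no; does; contradiction)
open import Relation.Binary using (tri<; tri≈; tri>)
open import Relation.Binary.PropositionalEquality
open import Algebra.Properties.CommutativeSemigroup ℕ.+-commutativeSemigroup using (interchange)
open import Algebra.Properties.CommutativeSemigroup ℤ.+-commutativeSemigroup using () renaming (interchange to interchangeℤ)

-- Indicators and finite sums of integers

𝟙 : Bool → ℕ
𝟙 b = if b then 1 else 0

δ : ∀ {n} → Fin n → Fin n → ℕ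
δ x y = 𝟙 (does (x Fin.≟ y))

sumℤ : ∀ {n} → (Fin n → ℤ) → ℤ
sumℤ {zero}  f = 0ℤ
sumℤ {suc n} f = f fzero +ℤ sumℤ (λ i → f (fsuc i))

sumℤ-cong : ∀ {n} {f g : Fin n → ℤ} → (∀ i → f i ≡ g i) → sumℤ f ≡ sumℤ g
sumℤ-cong {zero}  f≡g = refl
sumℤ-cong {suc n} f≡g = cong₂ _+ℤ_ (f≡g fzero) (sumℤ-cong (λ i → f≡g (fsuc i)))

sumℤ-0 : ∀ n → sumℤ {n} (λ _ → 0ℤ) ≡ 0ℤ
sumℤ-0 zero    = refl
sumℤ-0 (suc n) = trans (ℤ.+-identityˡ _) (sumℤ-0 n)

sumℤ-+ : ∀ n (f g : Fin n → ℤ) → sumℤ (λ i → f i +ℤ g i) ≡ sumℤ f +ℤ sumℤ g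
sumℤ-+ zero    f g = refl
sumℤ-+ (suc n) f g = trans (cong (_+ℤ_ (f fzero +ℤ g fzero)) (sumℤ-+ n _ _))
  (interchangeℤ (f fzero) (g fzero) _ _)

sumℤ-mono-≤ : ∀ {n} {f g : Fin n → ℤ} → (∀ i → f i ≤ℤ g i) → sumℤ f ≤ℤ sumℤ g
sumℤ-mono-≤ {zero}  f≤g = ℤ.≤-refl
sumℤ-mono-≤ {suc n} f≤g = ℤ.+-mono-≤ (f≤g fzero) (sumℤ-mono-≤ (λ i → f≤g (fsuc i)))

sumℤ-neg : ∀ {n} (f : Fin n → ℤ) → sumℤ (λ i → - f i) ≡ - sumℤ f
sumℤ-neg {zero}  f = refl
sumℤ-neg {suc n} f = trans (cong (_+ℤ_ (- f fzero)) (sumℤ-neg (λ i → f (fsuc i))))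
  (sym (ℤ.neg-distrib-+ (f fzero) (sumℤ (λ i → f (fsuc i)))))

sumℤ-single : ∀ {n} (p : Fin n) (k : Fin n → ℤ) →
  sumℤ (λ w → if does (p Fin.≟ w) then k w else 0ℤ) ≡ k p
sumℤ-single {suc n} fzero k = trans (cong (_+ℤ_ (k fzero)) (sumℤ-0 n)) (ℤ.+-identityʳ (k fzero))
sumℤ-single (fsuc p) k = trans (ℤ.+-identityˡ _) (sumℤ-single p (λ w → k (fsuc w)))

-- Hoffman's theorem

-- Net outflows between l w and u w are supplied to the nodes w from one implicit extra node;
-- the flag z tells whether the cut contains it, which unifies the lower and the upper cut conditions.
cutTerm : Bool → Bool → ℤ → ℤ → ℤ
cutTerm false x l u = if x then l else 0ℤ
cutTerm true  x l u = if x then 0ℤ else - u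

-- Equality holds unless one cut contains the node without the extra node and the other the extra
-- node without the node; only there does `l ≤ u` enter.
cutTerm-supermodular : ∀ z z′ x x′ {l u} → l ≤ℤ u →
  cutTerm z x l u +ℤ cutTerm z′ x′ l u ≤ℤ cutTerm (z ∧ z′) (x ∧ x′) l u +ℤ cutTerm (z ∨ z′) (x ∨ x′) l u
cutTerm-supermodular false false false false l≤u = ℤ.≤-refl
cutTerm-supermodular false false false true  l≤u = ℤ.≤-refl
cutTerm-supermodular false false true  false {l} l≤u = ℤ.≤-reflexive (ℤ.+-comm l 0ℤ)
cutTerm-supermodular false false true  true  l≤u = ℤ.≤-refl
cutTerm-supermodular false true  false false l≤u = ℤ.≤-refl
cutTerm-supermodular false true  false true  l≤u = ℤ.≤-refl
cutTerm-supermodular false true  true  false l≤u = ℤ.i≤j⇒i-j≤0 l≤u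
cutTerm-supermodular false true  true  true  l≤u = ℤ.≤-refl
cutTerm-supermodular true  false false false {l} {u} l≤u = ℤ.≤-reflexive (ℤ.+-comm (- u) 0ℤ)
cutTerm-supermodular true  false false true  {l} {u} l≤u = subst (_≤ℤ 0ℤ) (ℤ.+-comm l (- u)) (ℤ.i≤j⇒i-j≤0 l≤u)
cutTerm-supermodular true  false true  false l≤u = ℤ.≤-refl
cutTerm-supermodular true  false true  true  {l} l≤u = ℤ.≤-reflexive (ℤ.+-comm 0ℤ l)
cutTerm-supermodular true  true  false false l≤u = ℤ.≤-refl
cutTerm-supermodular true  true  false true  l≤u = ℤ.≤-refl
cutTerm-supermodular true  true  true  false {l} {u} l≤u = ℤ.≤-reflexive (ℤ.+-comm 0ℤ (- u))
cutTerm-supermodular true  true  true  true  l≤u = ℤ.≤-refl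

cutTerm-shift : ∀ z x l u k →
  cutTerm z x (l - k) (u - k) ≡ cutTerm z x l u +ℤ ((if z then k else 0ℤ) +ℤ - (if x then k else 0ℤ))
cutTerm-shift false false l u k = refl
cutTerm-shift false true  l u k = cong (_+ℤ_ l) (sym (ℤ.+-identityˡ (- k)))
cutTerm-shift true  false l u k = identity u k
  where
  identity : ∀ u k → - (u - k) ≡ - u +ℤ (k +ℤ - 0ℤ)
  identity = solveℤ-∀
cutTerm-shift true  true  l u k = sym (trans (ℤ.+-identityˡ _) (ℤ.+-inverseʳ k))

cancel : ∀ k l → k +ℤ (l - k) ≡ l
cancel = solveℤ-∀

total : {A : Set} → (A → ℕ) → List A → ℕ
total v es = sum (map v es)

module Digraph {A : Set} {N : ℕ} (src tgt : A → Fin N) where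

  arcNet : A → Fin N → ℤ
  arcNet e w = + δ (src e) w - + δ (tgt e) w

  net : List A → Fin N → ℤ
  net []       w = 0ℤ
  net (e ∷ es) w = arcNet e w +ℤ net es w

  leaves : (Fin N → Bool) → A → ℕ
  leaves X e = 𝟙 (X (src e) ∧ not (X (tgt e)))

  -- `leaves` is the positive part of the net flow of `e` out of `X`, so the two agree unless `e`
  -- enters `X`. The last premise holds by `refl` in each of the other three cases.
  leaves-exact : ∀ X e {x x′} → X (src e) ≡ x → X (tgt e) ≡ x′ → + 𝟙 (x ∧ not x′) ≡ + 𝟙 x - + 𝟙 x′ →
    + leaves X e ≡ + 𝟙 (X (src e)) - + 𝟙 (X (tgt e))
  leaves-exact X e refl refl eq = eq

  -- Strict only for an arc between `X` minus `Y` and `Y` minus `X`, in either direction: it leaves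
  -- one of the sets, but neither the intersection nor the union.
  leaves-submodular : ∀ X Y e →
    leaves (λ w → X w ∧ Y w) e + leaves (λ w → X w ∨ Y w) e ≤ leaves X e + leaves Y e
  leaves-submodular X Y e with X (src e) | X (tgt e) | Y (src e) | Y (tgt e)
  ... | false | _     | false | _     = z≤n
  ... | false | false | true  | false = ℕ.≤-refl
  ... | false | false | true  | true  = ℕ.≤-refl
  ... | false | true  | true  | _     = z≤n
  ... | true  | false | false | false = ℕ.≤-refl
  ... | true  | false | false | true  = z≤n
  ... | true  | true  | false | _     = z≤n
  ... | true  | false | true  | false = ℕ.≤-refl
  ... | true  | false | true  | true  = ℕ.≤-refl
  ... | true  | true  | true  | false = ℕ.≤-refl
  ... | true  | true  | true  | true  = ℕ.≤-refl

  outflow : (Fin N → Bool) → List A → ℕ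
  outflow X = total (leaves X)

  outflow-submodular : ∀ X Y es →
    outflow (λ w → X w ∧ Y w) es + outflow (λ w → X w ∨ Y w) es ≤ outflow X es + outflow Y es
  outflow-submodular X Y []       = z≤n
  outflow-submodular X Y (e ∷ es) = subst₂ _≤_
    (interchange (leaves (λ w → X w ∧ Y w) e) _ _ _) (interchange (leaves X e) _ _ _)
    (ℕ.+-mono-≤ (leaves-submodular X Y e) (outflow-submodular X Y es))

  cutValue : Bool → (Fin N → Bool) → (l u : Fin N → ℤ) → ℤ
  cutValue z X l u = sumℤ (λ w → cutTerm z (X w) (l w) (u w))

  cutValue-supermodular : ∀ z z′ X Y {l u} → (∀ w → l w ≤ℤ u w) →
    cutValue z X l u +ℤ cutValue z′ Y l u
      ≤ℤ cutValue (z ∧ z′) (λ w → X w ∧ Y w) l u +ℤ cutValue (z ∨ z′) (λ w → X w ∨ Y w) l u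
  cutValue-supermodular z z′ X Y l≤u = subst₂ _≤ℤ_ (sumℤ-+ N _ _) (sumℤ-+ N _ _)
    (sumℤ-mono-≤ (λ w → cutTerm-supermodular z z′ (X w) (Y w) (l≤u w)))

  netOver : ∀ (X : Fin N → Bool) e → sumℤ (λ w → if X w then arcNet e w else 0ℤ) ≡ + 𝟙 (X (src e)) - + 𝟙 (X (tgt e))
  netOver X e = trans (sumℤ-cong (λ w → split (X w) (does (src e Fin.≟ w)) (does (tgt e Fin.≟ w)))) (trans (sumℤ-+ N _ _)
    (cong₂ _+ℤ_ (sumℤ-single (src e) (λ w → + 𝟙 (X w)))
      (trans (sumℤ-neg {N} _) (cong -_ (sumℤ-single (tgt e) (λ w → + 𝟙 (X w)))))))
    where
    split : ∀ x p q → (if x then + 𝟙 p - + 𝟙 q else 0ℤ) ≡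
      (if p then + 𝟙 x else 0ℤ) +ℤ - (if q then + 𝟙 x else 0ℤ)
    split false false false = refl
    split false false true  = refl
    split false true  false = refl
    split false true  true  = refl
    split true  false false = refl
    split true  false true  = refl
    split true  true  false = refl
    split true  true  true  = refl

  netOver-all : ∀ z e → sumℤ (λ w → if z then arcNet e w else 0ℤ) ≡ 0ℤ
  netOver-all z e = trans (netOver (λ _ → z) e) (ℤ.+-inverseʳ (+ 𝟙 z))

  -- Reserving the arc `e` lowers the value by the net flow of `e` out of `X`. The flag `z` adds the
  -- net flow of `e` over all nodes, which is zero.
  cutValue-shift : ∀ z X l u e →
    cutValue z X (λ w → l w - arcNet e w) (λ w → u w - arcNet e w)
      ≡ cutValue z X l u - (+ 𝟙 (X (src e)) - + 𝟙 (X (tgt e)))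
  cutValue-shift z X l u e = begin
    cutValue z X (λ w → l w - arcNet e w) (λ w → u w - arcNet e w)
      ≡⟨ sumℤ-cong (λ w → cutTerm-shift z (X w) (l w) (u w) (arcNet e w)) ⟩
    sumℤ (λ w → cutTerm z (X w) (l w) (u w) +ℤ ((if z then arcNet e w else 0ℤ) +ℤ - (if X w then arcNet e w else 0ℤ)))
      ≡⟨ sumℤ-+ N _ _ ⟩
    cutValue z X l u +ℤ sumℤ (λ w → (if z then arcNet e w else 0ℤ) +ℤ - (if X w then arcNet e w else 0ℤ))
      ≡⟨ cong (_+ℤ_ (cutValue z X l u)) (trans (sumℤ-+ N _ _)
           (cong₂ _+ℤ_ (netOver-all z e) (trans (sumℤ-neg {N} _) (cong -_ (netOver X e))))) ⟩
    cutValue z X l u +ℤ (0ℤ +ℤ - (+ 𝟙 (X (src e)) - + 𝟙 (X (tgt e))))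
      ≡⟨ cong (_+ℤ_ (cutValue z X l u)) (ℤ.+-identityˡ (- (+ 𝟙 (X (src e)) - + 𝟙 (X (tgt e))))) ⟩
    cutValue z X l u - (+ 𝟙 (X (src e)) - + 𝟙 (X (tgt e))) ∎
    where open ≡-Reasoning

  -- Net flows sum to zero, so the net flow out of `X` is at least the sum of `l` over `X` (`z`
  -- false) and at least minus the sum of `u` outside `X` (`z` true). In a violated cut too few arcs
  -- leave `X` for one of these.
  ViolatedCut : List A → (l u : Fin N → ℤ) → Set
  ViolatedCut es l u = ∃₂ λ z X → + outflow X es <ℤ cutValue z X l u

  Balanced : List A → (l u : Fin N → ℤ) → Set
  Balanced fs l u = ∀ w → l w ≤ℤ net fs w × net fs w ≤ℤ u w

  violated-stays : ∀ {es l u} z X e → leaves X e ≡ 0 → + outflow X es <ℤ cutValue z X l u →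
    + outflow X (e ∷ es) <ℤ cutValue z X l u
  violated-stays z X e e-stays viol rewrite e-stays = viol

  violated-unshift : ∀ {es l u} z X e → + leaves X e ≡ + 𝟙 (X (src e)) - + 𝟙 (X (tgt e)) →
    + outflow X es <ℤ cutValue z X (λ w → l w - arcNet e w) (λ w → u w - arcNet e w) →
    + outflow X (e ∷ es) <ℤ cutValue z X l u
  violated-unshift {es} {l} {u} z X e e-term viol rewrite cutValue-shift z X l u e =
    subst₂ _<ℤ_ (cong₂ _+ℤ_ (sym e-term) refl) (cancel k (cutValue z X l u)) (ℤ.+-monoʳ-< k viol)
    where
    k : ℤ
    k = + 𝟙 (X (src e)) - + 𝟙 (X (tgt e))

  -- Both the intersection and the union avoid the arc e, so uncrossing loses nothing on it.
  violated-uncross : ∀ {es l u} z z′ X Y e → (∀ w → l w ≤ℤ u w) →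
    X (src e) ≡ true → X (tgt e) ≡ false → Y (src e) ≡ false → Y (tgt e) ≡ true →
    + outflow X es <ℤ cutValue z X l u →
    + outflow Y es <ℤ cutValue z′ Y (λ w → l w - arcNet e w) (λ w → u w - arcNet e w) →
    ViolatedCut (e ∷ es) l u
  violated-uncross {es} {l} {u} z z′ X Y e l≤u Xp Xq Yp Yq X-viol Y-viol
    with + outflow (λ w → X w ∧ Y w) es ℤ.<? cutValue (z ∧ z′) (λ w → X w ∧ Y w) l u
  ... | yes viol = z ∧ z′ , _ , violated-stays {es} {l} {u} (z ∧ z′) _ e stays viol
    where
    stays : leaves (λ w → X w ∧ Y w) e ≡ 0
    stays rewrite Xp | Yp = refl
  ... | no ¬viol = z ∨ z′ , _ , violated-stays {es} {l} {u} (z ∨ z′) _ e stays (ℤ.≰⇒> λ val∪≤ →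
      ℤ.<-irrefl refl (begin-strict
        + outflow X es +ℤ + outflow Y es
          -- `Y` contains only the target of `e`, so undoing the shift costs one; by integrality the
          -- strict violation at `X` pays for it.
          <⟨ ℤ.+-mono-≤-< (ℤ.i<j⇒i≤pred[j] X-viol) Y-viol ⟩
        ℤ.pred (cutValue z X l u) +ℤ cutValue z′ Y (λ w → l w - arcNet e w) (λ w → u w - arcNet e w)
          ≡⟨ cong (_+ℤ_ (ℤ.pred (cutValue z X l u))) shifted ⟩
        ℤ.pred (cutValue z X l u) +ℤ (cutValue z′ Y l u +ℤ 1ℤ)
          ≡⟨ regroup (cutValue z X l u) (cutValue z′ Y l u) ⟩
        cutValue z X l u +ℤ cutValue z′ Y l u
          ≤⟨ cutValue-supermodular z z′ X Y l≤u ⟩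
        cutValue (z ∧ z′) (λ w → X w ∧ Y w) l u +ℤ cutValue (z ∨ z′) (λ w → X w ∨ Y w) l u
          ≤⟨ ℤ.+-mono-≤ (ℤ.≮⇒≥ ¬viol) val∪≤ ⟩
        + outflow (λ w → X w ∧ Y w) es +ℤ + outflow (λ w → X w ∨ Y w) es
          ≤⟨ +≤+ (outflow-submodular X Y es) ⟩
        + outflow X es +ℤ + outflow Y es ∎))
    where
    open ℤ.≤-Reasoning
    stays : leaves (λ w → X w ∨ Y w) e ≡ 0
    stays rewrite Xp | Xq | Yq = refl
    shifted : cutValue z′ Y (λ w → l w - arcNet e w) (λ w → u w - arcNet e w) ≡ cutValue z′ Y l u +ℤ 1ℤ
    shifted = trans (cutValue-shift z′ Y l u e)
      (cong₂ (λ y y′ → cutValue z′ Y l u - (+ 𝟙 y - + 𝟙 y′)) Yp Yq)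
    regroup : ∀ v v′ → (- 1ℤ +ℤ v) +ℤ (v′ +ℤ 1ℤ) ≡ v +ℤ v′
    regroup = solveℤ-∀

  -- If `e` does not leave `X`, the cut `X` stays violated; if `e` does not enter `Y`, counting `e`
  -- in the outflow undoes the shift exactly. In the remaining case the two cuts are uncrossed.
  violated-∷ : ∀ {es l u e} → (∀ w → l w ≤ℤ u w) → ViolatedCut es l u →
    ViolatedCut es (λ w → l w - arcNet e w) (λ w → u w - arcNet e w) → ViolatedCut (e ∷ es) l u
  violated-∷ {es} {l} {u} {e} l≤u (z , X , X-viol) (z′ , Y , Y-viol)
    with X (src e) in Xp | X (tgt e) in Xq | Y (src e) in Yp | Y (tgt e) in Yq
  ... | false | _     | _     | _     =
    z , X , violated-stays {es} {l} {u} z X e (cong (λ x → 𝟙 (x ∧ not (X (tgt e)))) Xp) X-viol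
  ... | true  | true  | _     | _     =
    z , X , violated-stays {es} {l} {u} z X e (cong₂ (λ x x′ → 𝟙 (x ∧ not x′)) Xp Xq) X-viol
  ... | true  | false | false | true  = violated-uncross {es} z z′ X Y e l≤u Xp Xq Yp Yq X-viol Y-viol
  ... | true  | false | true  | true  = z′ , Y , violated-unshift {es} z′ Y e (leaves-exact Y e Yp Yq refl) Y-viol
  ... | true  | false | true  | false = z′ , Y , violated-unshift {es} z′ Y e (leaves-exact Y e Yp Yq refl) Y-viol
  ... | true  | false | false | false = z′ , Y , violated-unshift {es} z′ Y e (leaves-exact Y e Yp Yq refl) Y-viol

  -- Induction on the arcs: omit `e`, or take it and lower both bounds by its net flow. If both
  -- fail, the two violated cuts combine. A sublist is a 0/1 flow, so integrality is built in.
  hoffman : ∀ es l u → (∀ w → l w ≤ℤ u w) →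
    (∃ λ fs → fs ⊆ es × Balanced fs l u) ⊎ ViolatedCut es l u
  -- Without arcs all net flows vanish. A node with `l w > 0` is itself a violated cut; for
  -- `u w < 0` the cut is everything else, together with the extra node.
  hoffman [] l u l≤u with Fin.all? (λ w → l w ℤ.≤? 0ℤ) | Fin.all? (λ w → 0ℤ ℤ.≤? u w)
  ... | yes l≤0 | yes 0≤u = inj₁ ([] , [] , λ w → l≤0 w , 0≤u w)
  ... | no ¬l≤0 | _ with w , l≰0 ← Fin.¬∀⟶∃¬ N _ (λ w → l w ℤ.≤? 0ℤ) ¬l≤0 =
    inj₂ (false , (λ v → does (w Fin.≟ v)) , subst (0ℤ <ℤ_) (sym (sumℤ-single w l)) (ℤ.≰⇒> l≰0))
  ... | yes _ | no ¬0≤u with w , 0≰u ← Fin.¬∀⟶∃¬ N _ (λ w → 0ℤ ℤ.≤? u w) ¬0≤u =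
    inj₂ (true , (λ v → not (does (w Fin.≟ v))) , subst (0ℤ <ℤ_) (sym value) (ℤ.neg-mono-< (ℤ.≰⇒> 0≰u)))
    where
    value : cutValue true (λ v → not (does (w Fin.≟ v))) l u ≡ - u w
    value = trans (sumℤ-cong (λ v → swap { - u v} (does (w Fin.≟ v)))) (sumℤ-single w (λ v → - u v))
      where
      swap : ∀ {k} b → (if not b then 0ℤ else k) ≡ (if b then k else 0ℤ)
      swap false = refl
      swap true  = refl
  hoffman (e ∷ es) l u l≤u with hoffman es l u l≤u
  ... | inj₁ (fs , fs⊆es , ok) = inj₁ (fs , e ∷ʳ fs⊆es , ok)
  ... | inj₂ viol₀ with hoffman es _ _ (λ w → ℤ.+-monoˡ-≤ (- arcNet e w) (l≤u w))
  ... | inj₂ viol₁ = inj₂ (violated-∷ {es} l≤u viol₀ viol₁)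
  ... | inj₁ (fs , fs⊆es , ok) = inj₁ (e ∷ fs , refl ∷ fs⊆es , λ w →
      subst (_≤ℤ arcNet e w +ℤ net fs w) (cancel (arcNet e w) (l w)) (ℤ.+-monoʳ-≤ (arcNet e w) (proj₁ (ok w))) ,
      subst (arcNet e w +ℤ net fs w ≤ℤ_) (cancel (arcNet e w) (u w)) (ℤ.+-monoʳ-≤ (arcNet e w) (proj₂ (ok w))))

-- Finite sums of natural numbers

sumℕ-cong : ∀ {n} {f g : Fin n → ℕ} → (∀ i → f i ≡ g i) → sumℕ f ≡ sumℕ g
sumℕ-cong {zero}  f≡g = refl
sumℕ-cong {suc n} f≡g = cong₂ _+_ (f≡g fzero) (sumℕ-cong (λ i → f≡g (fsuc i)))

sumℕ-mono-≤ : ∀ {n} {f g : Fin n → ℕ} → (∀ i → f i ≤ g i) → sumℕ f ≤ sumℕ g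
sumℕ-mono-≤ {zero}  f≤g = z≤n
sumℕ-mono-≤ {suc n} f≤g = ℕ.+-mono-≤ (f≤g fzero) (sumℕ-mono-≤ (λ i → f≤g (fsuc i)))

sumℕ-0 : ∀ n → sumℕ {n} (λ _ → 0) ≡ 0
sumℕ-0 zero    = refl
sumℕ-0 (suc n) = sumℕ-0 n

sumℕ-+ : ∀ n (f g : Fin n → ℕ) → sumℕ (λ i → f i + g i) ≡ sumℕ f + sumℕ g
sumℕ-+ zero    f g = refl
sumℕ-+ (suc n) f g = trans (cong (_+_ (f fzero + g fzero)) (sumℕ-+ n _ _)) (interchange (f fzero) (g fzero) _ _)

sumℕ-*ˡ : ∀ n k (f : Fin n → ℕ) → sumℕ (λ i → k * f i) ≡ k * sumℕ f
sumℕ-*ˡ zero    k f = sym (ℕ.*-zeroʳ k)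
sumℕ-*ˡ (suc n) k f = trans (cong (_+_ (k * f fzero)) (sumℕ-*ˡ n k _)) (sym (ℕ.*-distribˡ-+ k (f fzero) _))

sumℕ-swap : ∀ m n (f : Fin m → Fin n → ℕ) →
  sumℕ (λ i → sumℕ (λ j → f i j)) ≡ sumℕ (λ j → sumℕ (λ i → f i j))
sumℕ-swap zero    n f = sym (sumℕ-0 n)
sumℕ-swap (suc m) n f = trans (cong (_+_ (sumℕ (f fzero))) (sumℕ-swap m n (λ i → f (fsuc i)))) (sym (sumℕ-+ n _ _))

sumℕ-single : ∀ {n} (p : Fin n) (k : Fin n → ℕ) → sumℕ (λ w → δ p w * k w) ≡ k p
sumℕ-single {suc n} fzero k = trans (cong₂ _+_ (ℕ.+-identityʳ (k fzero)) (sumℕ-0 n)) (ℕ.+-identityʳ (k fzero))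
sumℕ-single (fsuc p) k = sumℕ-single p (λ w → k (fsuc w))

count≡sumℕ : ∀ {n} (p : Fin n → Bool) → count p ≡ sumℕ (λ i → 𝟙 (p i))
count≡sumℕ {zero}  p = refl
count≡sumℕ {suc n} p = cong (_+_ (𝟙 (p fzero))) (count≡sumℕ (λ i → p (fsuc i)))

δ-sym : ∀ {n} (x y : Fin n) → δ x y ≡ δ y x
δ-sym fzero    fzero    = refl
δ-sym fzero    (fsuc y) = refl
δ-sym (fsuc x) fzero    = refl
δ-sym (fsuc x) (fsuc y) = δ-sym x y

δ-↑ˡ : ∀ {m} n (x y : Fin m) → δ (x ↑ˡ n) (y ↑ˡ n) ≡ δ x y
δ-↑ˡ n fzero    fzero    = refl
δ-↑ˡ n fzero    (fsuc y) = refl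
δ-↑ˡ n (fsuc x) fzero    = refl
δ-↑ˡ n (fsuc x) (fsuc y) = δ-↑ˡ n x y

δ-↑ʳ : ∀ m {n} (x y : Fin n) → δ (m ↑ʳ x) (m ↑ʳ y) ≡ δ x y
δ-↑ʳ zero    x y = refl
δ-↑ʳ (suc m) x y = δ-↑ʳ m x y

δ-↑ˡ-↑ʳ : ∀ {m n} (x : Fin m) (y : Fin n) → δ (x ↑ˡ n) (m ↑ʳ y) ≡ 0
δ-↑ˡ-↑ʳ fzero    y = refl
δ-↑ˡ-↑ʳ (fsuc x) y = δ-↑ˡ-↑ʳ x y

sumℤ-pos : ∀ n (f : Fin n → ℕ) → sumℤ (λ i → + f i) ≡ + sumℕ f
sumℤ-pos zero    f = refl
sumℤ-pos (suc n) f = cong (_+ℤ_ (+ f fzero)) (sumℤ-pos n (λ i → f (fsuc i)))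

sumℤ-split : ∀ m {n} (f : Fin (m + n) → ℤ) → sumℤ f ≡ sumℤ (λ i → f (i ↑ˡ n)) +ℤ sumℤ (λ j → f (m ↑ʳ j))
sumℤ-split zero    f = sym (ℤ.+-identityˡ (sumℤ f))
sumℤ-split (suc m) {n} f = trans (cong (_+ℤ_ (f fzero)) (sumℤ-split m (λ i → f (fsuc i))))
  (sym (ℤ.+-assoc (f fzero) (sumℤ (λ i → f (fsuc i ↑ˡ n))) (sumℤ (λ j → f (fsuc (m ↑ʳ j))))))

total-++ : ∀ {A : Set} (v : A → ℕ) xs ys → total v (xs ++ ys) ≡ total v xs + total v ys
total-++ v []       ys = refl
total-++ v (x ∷ xs) ys = trans (cong (_+_ (v x)) (total-++ v xs ys)) (sym (ℕ.+-assoc (v x) _ _))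

total-concat : ∀ {A : Set} {n} (v : A → ℕ) (F : Fin n → List A) →
  total v (concat (tabulate F)) ≡ sumℕ (λ i → total v (F i))
total-concat {n = zero}  v F = refl
total-concat {n = suc n} v F = trans (total-++ v (F fzero) _) (cong (_+_ (total v (F fzero))) (total-concat v (λ i → F (fsuc i))))

total-mono-⊆ : ∀ {A : Set} (v : A → ℕ) {fs es} → fs ⊆ es → total v fs ≤ total v es
total-mono-⊆ v []            = z≤n
total-mono-⊆ v (e ∷ʳ fs⊆es)  = ℕ.m≤n⇒m≤o+n (v e) (total-mono-⊆ v fs⊆es)
total-mono-⊆ v (_∷_ {x = x} refl fs⊆es) = ℕ.+-monoʳ-≤ (v x) (total-mono-⊆ v fs⊆es)

total-cong : ∀ {A : Set} {v v′ : A → ℕ} → (∀ e → v e ≡ v′ e) → ∀ es → total v es ≡ total v′ es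
total-cong v≡v′ []       = refl
total-cong v≡v′ (e ∷ es) = cong₂ _+_ (v≡v′ e) (total-cong v≡v′ es)

sumℕ-total : ∀ {A : Set} n (v : Fin n → A → ℕ) es → sumℕ (λ i → total (v i) es) ≡ total (λ e → sumℕ (λ i → v i e)) es
sumℕ-total n v []       = sumℕ-0 n
sumℕ-total n v (e ∷ es) = trans (sumℕ-+ n _ _) (cong (_+_ (sumℕ (λ i → v i e))) (sumℕ-total n v es))

-- The criterion for fractional factors

sumOver : ∀ {n} → (Fin n → Bool) → (Fin n → ℕ) → ℕ
sumOver p v = sumℕ (λ x → 𝟙 (p x) * v x)

degOutside : ∀ {n} → (Fin n → Fin n → Bool) → (Fin n → Bool) → Fin n → ℕ
degOutside E S x = count (λ y → E x y ∧ not (S y))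

-- `S` and `T` may overlap here; `Uncrossing` makes them disjoint.
Deficient : ∀ {n} → (E : Fin n → Fin n → Bool) (g f : Fin n → ℕ) (S T : Fin n → Bool) → Set
Deficient E g f S T = sumOver S f + sumOver T (degOutside E S) < sumOver T g

-- Vertex x of the graph becomes x ↑ˡ n on the left and n ↑ʳ x on the right.
module DoubleCover {n : ℕ} (E : Fin n → Fin n → Bool) (E-sym : ∀ x y → E x y ≡ E y x)
  (g f : Fin n → ℕ) (g≤f : ∀ x → g x ≤ f x) where

  Arc : Set
  Arc = Fin n × Fin n

  open Digraph {Arc} {n + n} (λ (x , _) → x ↑ˡ n) (λ (_ , y) → n ↑ʳ y)

  arcs : List Arc
  arcs = concat (tabulate λ x → concat (tabulate λ y → if E x y then (x , y) ∷ [] else []))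

  total-arcs : ∀ v → total v arcs ≡ sumℕ (λ x → sumℕ (λ y → 𝟙 (E x y) * v (x , y)))
  total-arcs v = trans (total-concat {n = n} v _)
    (sumℕ-cong λ x → trans (total-concat {n = n} v _) (sumℕ-cong (single x)))
    where
    single : ∀ x y → total v (if E x y then (x , y) ∷ [] else []) ≡ 𝟙 (E x y) * v (x , y)
    single x y with E x y
    ... | false = refl
    ... | true  = refl

  -- A right copy only receives arcs, so its net flow is minus its degree and the roles of `g` and
  -- `f` swap.
  lower upper : Fin (n + n) → ℤ
  lower w = [ (λ x → + g x) , (λ y → - (+ f y)) ]′ (splitAt n w)
  upper w = [ (λ x → + f x) , (λ y → - (+ g y)) ]′ (splitAt n w)

  lower≤upper : ∀ w → lower w ≤ℤ upper w
  lower≤upper w with splitAt n w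
  ... | inj₁ x = ℤ.+≤+ (g≤f x)
  ... | inj₂ y = ℤ.neg-mono-≤ (ℤ.+≤+ (g≤f y))

  row col : List Arc → Fin n → ℕ
  row fs x = total (λ (x′ , _) → δ x′ x) fs
  col fs y = total (λ (_ , y′) → δ y′ y) fs

  net-left : ∀ fs x → net fs (x ↑ˡ n) ≡ + row fs x
  net-left []             x = refl
  net-left ((x′ , y′) ∷ fs) x
    rewrite δ-↑ˡ n x′ x | δ-sym (n ↑ʳ y′) (x ↑ˡ n) | δ-↑ˡ-↑ʳ x y′ | net-left fs x
          | ℕ.+-identityʳ (δ x′ x) = refl

  net-right : ∀ fs y → net fs (n ↑ʳ y) ≡ - (+ col fs y)
  net-right []               y = refl
  net-right ((x′ , y′) ∷ fs) y
    rewrite δ-↑ʳ n y′ y | δ-↑ˡ-↑ʳ x′ y | net-right fs y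
          | ℤ.+-identityˡ (- (+ δ y′ y)) = sym (ℤ.neg-distrib-+ (+ δ y′ y) (+ col fs y))

  outflow-arcs : ∀ X → outflow X arcs ≡ sumℕ (λ x → sumℕ (λ y → 𝟙 (E x y) * 𝟙 (X (x ↑ˡ n) ∧ not (X (n ↑ʳ y)))))
  outflow-arcs X = total-arcs (leaves X)

  scale-deg : ∀ (S T : Fin n → Bool) x →
    sumℕ (λ y → 𝟙 (E x y) * 𝟙 (T x ∧ not (S y))) ≡ 𝟙 (T x) * degOutside E S x
  scale-deg S T x = trans (sumℕ-cong (λ y → regroup (E x y) (T x) (S y)))
    (trans (sumℕ-*ˡ n (𝟙 (T x)) _) (cong (𝟙 (T x) *_) (sym (count≡sumℕ {n} _))))
    where
    regroup : ∀ e t s → 𝟙 e * 𝟙 (t ∧ not s) ≡ 𝟙 t * 𝟙 (e ∧ not s)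
    regroup false false s = refl
    regroup false true  s = refl
    regroup true  false s = refl
    regroup true  true  s = refl

  positive-difference : ∀ {e p q} → + e <ℤ + p +ℤ - (+ q) → q + e < p
  positive-difference {e} {p} {q} lt = ℤ.drop‿+<+ (subst₂ _<ℤ_ refl shift (ℤ.+-monoʳ-< (+ q) lt))
    where
    shift : + q +ℤ (+ p +ℤ - (+ q)) ≡ + p
    shift = cancel (+ q) (+ p)

  -- For `z` false, the arcs leaving the cut run from `T` on the left to the vertices outside `S` on
  -- the right. For `z` true, `S` and `T` come from the complement and the arcs run from outside `S`
  -- on the left to `T` on the right; `E-sym` turns them around.
  cut-deficient : ViolatedCut arcs lower upper → ∃₂ λ S T → Deficient E g f S T
  cut-deficient (false , X , viol) = S , T , positive-difference (subst₂ _<ℤ_ (cong +_ flow) value viol)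
    where
    S T : Fin n → Bool
    S y = X (n ↑ʳ y)
    T x = X (x ↑ˡ n)
    flow : outflow X arcs ≡ sumOver T (degOutside E S)
    flow = trans (outflow-arcs X) (sumℕ-cong (scale-deg S T))
    value : cutValue false X lower upper ≡ + sumOver T g +ℤ - (+ sumOver S f)
    value = trans (sumℤ-split n _) (cong₂ _+ℤ_
      (trans (sumℤ-cong left) (sumℤ-pos n _))
      (trans (sumℤ-cong right) (trans (sumℤ-neg {n} _) (cong -_ (sumℤ-pos n _)))))
      where
      left : ∀ x → cutTerm false (X (x ↑ˡ n)) (lower (x ↑ˡ n)) (upper (x ↑ˡ n)) ≡ + (𝟙 (T x) * g x)
      left x rewrite Fin.splitAt-↑ˡ n x n with X (x ↑ˡ n)
      ... | false = refl
      ... | true  = cong +_ (sym (ℕ.+-identityʳ (g x)))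
      right : ∀ y → cutTerm false (X (n ↑ʳ y)) (lower (n ↑ʳ y)) (upper (n ↑ʳ y)) ≡ - (+ (𝟙 (S y) * f y))
      right y rewrite Fin.splitAt-↑ʳ n n y with X (n ↑ʳ y)
      ... | false = refl
      ... | true  = cong (λ k → - (+ k)) (sym (ℕ.+-identityʳ (f y)))
  cut-deficient (true , X , viol) = S , T , positive-difference (subst₂ _<ℤ_ (cong +_ flow) value viol)
    where
    S T : Fin n → Bool
    S x = not (X (x ↑ˡ n))
    T y = not (X (n ↑ʳ y))
    flow : outflow X arcs ≡ sumOver T (degOutside E S)
    flow = trans (outflow-arcs X) (trans (sumℕ-swap n n _)
      (sumℕ-cong (λ y → trans (sumℕ-cong (λ x → flip y x)) (scale-deg S T y))))
      where
      flip-bool : ∀ e p q → 𝟙 e * 𝟙 (p ∧ q) ≡ 𝟙 e * 𝟙 (q ∧ not (not p))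
      flip-bool e false false = refl
      flip-bool e false true  = refl
      flip-bool e true  false = refl
      flip-bool e true  true  = refl
      flip : ∀ y x → 𝟙 (E x y) * 𝟙 (X (x ↑ˡ n) ∧ not (X (n ↑ʳ y))) ≡ 𝟙 (E y x) * 𝟙 (T y ∧ not (S x))
      flip y x rewrite E-sym x y = flip-bool (E y x) (X (x ↑ˡ n)) (not (X (n ↑ʳ y)))
    value : cutValue true X lower upper ≡ + sumOver T g +ℤ - (+ sumOver S f)
    value = trans (sumℤ-split n _) (trans (cong₂ _+ℤ_
      (trans (sumℤ-cong left) (trans (sumℤ-neg {n} _) (cong -_ (sumℤ-pos n _))))
      (trans (sumℤ-cong right) (sumℤ-pos n _))) (ℤ.+-comm (- (+ sumOver S f)) (+ sumOver T g)))
      where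
      left : ∀ x → cutTerm true (X (x ↑ˡ n)) (lower (x ↑ˡ n)) (upper (x ↑ˡ n)) ≡ - (+ (𝟙 (S x) * f x))
      left x rewrite Fin.splitAt-↑ˡ n x n with X (x ↑ˡ n)
      ... | false = cong (λ k → - (+ k)) (sym (ℕ.+-identityʳ (f x)))
      ... | true  = refl
      right : ∀ y → cutTerm true (X (n ↑ʳ y)) (lower (n ↑ʳ y)) (upper (n ↑ʳ y)) ≡ + (𝟙 (T y) * g y)
      right y rewrite Fin.splitAt-↑ʳ n n y with X (n ↑ʳ y)
      ... | false = trans (ℤ.neg-involutive (+ g y)) (cong +_ (sym (ℕ.+-identityʳ (g y))))
      ... | true  = refl

  -- The chosen arcs as a matrix, which need not be symmetric. Its entries are 0 or 1 because each
  -- arc occurs at most once in `arcs`.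
  multiplicity : List Arc → Fin n → Fin n → ℕ
  multiplicity fs x y = total (λ (x′ , y′) → δ x x′ * δ y y′) fs

  multiplicity-arcs : ∀ x y → multiplicity arcs x y ≡ 𝟙 (E x y)
  multiplicity-arcs x y = begin
    multiplicity arcs x y                                           ≡⟨ total-arcs _ ⟩
    sumℕ (λ x′ → sumℕ (λ y′ → 𝟙 (E x′ y′) * (δ x x′ * δ y y′)))     ≡⟨ sumℕ-cong (λ x′ → sumℕ-cong (λ y′ → rearrange (𝟙 (E x′ y′)) (δ x x′) (δ y y′))) ⟩
    sumℕ (λ x′ → sumℕ (λ y′ → δ x x′ * (δ y y′ * 𝟙 (E x′ y′))))     ≡⟨ sumℕ-cong (λ x′ → trans (sumℕ-*ˡ n (δ x x′) _) (cong (δ x x′ *_) (sumℕ-single y _))) ⟩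
    sumℕ (λ x′ → δ x x′ * 𝟙 (E x′ y))                               ≡⟨ sumℕ-single x _ ⟩
    𝟙 (E x y)                                                       ∎
    where
    open ≡-Reasoning
    rearrange : ∀ e p q → e * (p * q) ≡ p * (q * e)
    rearrange e p q = trans (ℕ.*-comm e (p * q)) (ℕ.*-assoc p q e)

  sum-multiplicity-row : ∀ fs x → sumℕ (multiplicity fs x) ≡ row fs x
  sum-multiplicity-row fs x = trans (sumℕ-total n _ fs) (total-cong (λ (x′ , y′) → point x′ y′) fs)
    where
    point : ∀ x′ y′ → sumℕ (λ y → δ x x′ * δ y y′) ≡ δ x′ x
    point x′ y′ = trans (sumℕ-cong (λ y → trans (ℕ.*-comm (δ x x′) (δ y y′)) (cong₂ _*_ (δ-sym y y′) (δ-sym x x′))))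
      (sumℕ-single y′ (λ _ → δ x′ x))

  sum-multiplicity-col : ∀ fs y → sumℕ (λ x → multiplicity fs x y) ≡ col fs y
  sum-multiplicity-col fs y = trans (sumℕ-total n _ fs) (total-cong (λ (x′ , y′) → point x′ y′) fs)
    where
    point : ∀ x′ y′ → sumℕ (λ x → δ x x′ * δ y y′) ≡ δ y′ y
    point x′ y′ = trans (sumℕ-cong (λ x → cong₂ _*_ (δ-sym x x′) (δ-sym y y′))) (sumℕ-single x′ (λ _ → δ y′ y))

  BipartiteFactor : (Fin n → Fin n → ℕ) → Set
  BipartiteFactor φ = (∀ x y → φ x y ≤ 𝟙 (E x y))
    × (∀ x → g x ≤ sumℕ (φ x) × sumℕ (φ x) ≤ f x)
    × (∀ y → g y ≤ sumℕ (λ x → φ x y) × sumℕ (λ x → φ x y) ≤ f y)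

  bipartite-factor : ∃ BipartiteFactor ⊎ ∃₂ λ S T → Deficient E g f S T
  bipartite-factor with hoffman arcs lower upper lower≤upper
  ... | inj₂ viol = inj₂ (cut-deficient viol)
  ... | inj₁ (fs , fs⊆ , balanced) = inj₁ (multiplicity fs , bounded , rows , cols)
    where
    bounded : ∀ x y → multiplicity fs x y ≤ 𝟙 (E x y)
    bounded x y = ℕ.≤-trans (total-mono-⊆ _ fs⊆) (ℕ.≤-reflexive (multiplicity-arcs x y))
    rows : ∀ x → g x ≤ sumℕ (multiplicity fs x) × sumℕ (multiplicity fs x) ≤ f x
    rows x with balanced (x ↑ˡ n)
    ... | lo , hi rewrite Fin.splitAt-↑ˡ n x n | net-left fs x | sum-multiplicity-row fs x = ℤ.drop‿+≤+ lo , ℤ.drop‿+≤+ hi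
    cols : ∀ y → g y ≤ sumℕ (λ x → multiplicity fs x y) × sumℕ (λ x → multiplicity fs x y) ≤ f y
    cols y with balanced (n ↑ʳ y)
    ... | lo , hi rewrite Fin.splitAt-↑ʳ n n y | net-right fs y | sum-multiplicity-col fs y =
      ℤ.drop‿+≤+ (ℤ.neg-cancel-≤ hi) , ℤ.drop‿+≤+ (ℤ.neg-cancel-≤ lo)

-- Half-integral weights

half : ℕ → ℚ
half k = + k ℚ./ 2

half-+ : ∀ j k → half j ℚ.+ half k ≡ half (j + k)
half-+ j k = ℚ.toℚᵘ-injective (begin
  toℚᵘ (half j ℚ.+ half k)          ≈⟨ ℚ.toℚᵘ-homo-+ (half j) (half k) ⟩
  toℚᵘ (half j) ℚᵘ.+ toℚᵘ (half k)  ≈⟨ ℚᵘ.+-cong (ℚ.toℚᵘ-fromℚᵘ (mkℚᵘ (+ j) 1)) (ℚ.toℚᵘ-fromℚᵘ (mkℚᵘ (+ k) 1)) ⟩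
  mkℚᵘ (+ j) 1 ℚᵘ.+ mkℚᵘ (+ k) 1    ≈⟨ *≡* (identity (+ j) (+ k)) ⟩
  mkℚᵘ (+ (j + k)) 1                ≈⟨ ℚᵘ.≃-sym (ℚ.toℚᵘ-fromℚᵘ (mkℚᵘ (+ (j + k)) 1)) ⟩
  toℚᵘ (half (j + k))               ∎)
  where
  open import Relation.Binary.Reasoning.Setoid ℚᵘ.≃-setoid
  identity : ∀ j k → (j ℤ.* + 2 +ℤ k ℤ.* + 2) ℤ.* + 2 ≡ (j +ℤ k) ℤ.* + 4
  identity = solveℤ-∀

half-mono-≤ : ∀ {j k} → j ≤ k → half j ℚ.≤ half k
half-mono-≤ {j} {k} j≤k = ℚ.toℚᵘ-cancel-≤ (ℚᵘ.≤-respˡ-≃ (ℚᵘ.≃-sym (ℚ.toℚᵘ-fromℚᵘ (mkℚᵘ (+ j) 1)))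
  (ℚᵘ.≤-respʳ-≃ (ℚᵘ.≃-sym (ℚ.toℚᵘ-fromℚᵘ (mkℚᵘ (+ k) 1))) (*≤* (ℤ.*-monoʳ-≤-nonNeg (+ 2) (ℤ.+≤+ j≤k)))))

half-double : ∀ k → half (k + k) ≡ ℕtoℚ k
half-double k = ℚ.fromℚᵘ-cong {mkℚᵘ (+ (k + k)) 1} {mkℚᵘ (+ k) 0} (*≡* (identity (+ k)))
  where
  identity : ∀ k → (k +ℤ k) ℤ.* + 1 ≡ k ℤ.* + 2
  identity = solveℤ-∀

sumℚ-cong : ∀ {n} {f g : Fin n → ℚ} → (∀ i → f i ≡ g i) → sumℚ f ≡ sumℚ g
sumℚ-cong {zero}  f≡g = refl
sumℚ-cong {suc n} f≡g = cong₂ ℚ._+_ (f≡g fzero) (sumℚ-cong (λ i → f≡g (fsuc i)))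

sumℚ-half : ∀ n (k : Fin n → ℕ) → sumℚ (λ i → half (k i)) ≡ half (sumℕ k)
sumℚ-half zero    k = refl
sumℚ-half (suc n) k = trans (cong (half (k fzero) ℚ.+_) (sumℚ-half n (λ i → k (fsuc i)))) (half-+ (k fzero) _)

∧-true : ∀ {p q} → p ∧ q ≡ true → p ≡ true × q ≡ true
∧-true {true} {true} _ = refl , refl

-- Making a deficient pair disjoint

module Uncrossing {n : ℕ} {V : Fin n → Bool} {E : Fin n → Fin n → Bool} (E-sym : ∀ x y → E x y ≡ E y x)
  (E⊆V : ∀ x y → E x y ≡ true → V y ≡ true) {g f : Fin n → ℕ} (g≤f : ∀ x → g x ≤ f x)
  (S₀ T₀ : Fin n → Bool) where

  -- The overlap of `S₀` and `T₀` leaves both sets, which is harmless as `g ≤ f`. `T` also drops the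
  -- vertices of `T₁` with degree at least `g`, as they do not help the deficiency.
  S T₁ T : Fin n → Bool
  S x  = V x ∧ S₀ x ∧ not (T₀ x)
  T₁ x = V x ∧ T₀ x ∧ not (S₀ x)
  T x  = T₁ x ∧ does (degOutside E S x ℕ.<? g x)

  sumOver-deg : ∀ (P Q : Fin n → Bool) →
    sumOver P (degOutside E Q) ≡ sumℕ (λ x → sumℕ (λ y → 𝟙 (P x) * 𝟙 (E x y ∧ not (Q y))))
  sumOver-deg P Q = sumℕ-cong λ x → trans (cong (𝟙 (P x) *_) (count≡sumℕ {n} _)) (sym (sumℕ-*ˡ n (𝟙 (P x)) _))

  -- The edges between T₁ and S₀ ∩ T₀ are counted from the T₁ end on the left
  -- and from the other end on the right.
  deg-uncross : sumOver T₁ (degOutside E S) ≤ sumOver T₀ (degOutside E S₀)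
  deg-uncross = begin
    sumOver T₁ (degOutside E S)
      ≡⟨ sumOver-deg T₁ S ⟩
    sumℕ (λ x → sumℕ (λ y → 𝟙 (T₁ x) * 𝟙 (E x y ∧ not (S y))))
      -- The end `y` of an edge lies in `V`, so outside `S` it is either outside `S₀` or in both
      -- `S₀` and `T₀`.
      ≤⟨ sumℕ-mono-≤ (λ x → sumℕ-mono-≤ (λ y → split (V x) (S₀ x) (T₀ x) (S₀ y) (T₀ y) (E⊆V x y))) ⟩
    sumℕ (λ x → sumℕ (λ y → A x y + B x y))
      ≡⟨ split-sum (λ x y → B x y) ⟩
    sumℕ (λ x → sumℕ (λ y → A x y)) + sumℕ (λ x → sumℕ (λ y → B x y))
      ≡⟨ cong (_+_ (sumℕ (λ x → sumℕ (λ y → A x y)))) (sumℕ-swap n n B) ⟩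
    sumℕ (λ x → sumℕ (λ y → A x y)) + sumℕ (λ x → sumℕ (λ y → B y x))
      ≡⟨ split-sum (λ x y → B y x) ⟨
    sumℕ (λ x → sumℕ (λ y → A x y + B y x))
      -- A vertex of `T₁` is not in `S₀`, so at most one of the two terms is nonzero.
      ≤⟨ sumℕ-mono-≤ (λ x → sumℕ-mono-≤ (λ y → merge (V x) (S₀ x) (T₀ x) (V y) (S₀ y) (T₀ y) (E-sym x y))) ⟩
    sumℕ (λ x → sumℕ (λ y → 𝟙 (T₀ x) * 𝟙 (E x y ∧ not (S₀ y))))
      ≡⟨ sumOver-deg T₀ S₀ ⟨
    sumOver T₀ (degOutside E S₀) ∎
    where
    open ℕ.≤-Reasoning
    A B : Fin n → Fin n → ℕ
    A x y = 𝟙 (T₁ x ∧ E x y ∧ not (S₀ y))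
    B x y = 𝟙 (T₁ x ∧ E x y ∧ S₀ y ∧ T₀ y)
    split-sum : ∀ (C : Fin n → Fin n → ℕ) → sumℕ (λ x → sumℕ (λ y → A x y + C x y)) ≡
      sumℕ (λ x → sumℕ (λ y → A x y)) + sumℕ (λ x → sumℕ (λ y → C x y))
    split-sum C = trans (sumℕ-cong {n} (λ x → sumℕ-+ n (A x) (C x))) (sumℕ-+ n _ _)
    split : ∀ v s t s′ t′ {e v′} → (e ≡ true → v′ ≡ true) →
      𝟙 (v ∧ t ∧ not s) * 𝟙 (e ∧ not (v′ ∧ s′ ∧ not t′))
        ≤ 𝟙 ((v ∧ t ∧ not s) ∧ e ∧ not s′) + 𝟙 ((v ∧ t ∧ not s) ∧ e ∧ s′ ∧ t′)
    split false s     t     s′    t′    imp = z≤n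
    split true  s     false s′    t′    imp = z≤n
    split true  true  true  s′    t′    imp = z≤n
    split true  false true  s′    t′    {false} imp = z≤n
    split true  false true  false t′    {true} {v′} imp with v′ | imp refl
    ... | true | refl = ℕ.≤-refl
    split true  false true  true  t′    {true} {v′} imp with v′ | imp refl
    split true  false true  true  false {true} {v′} imp | true | refl = z≤n
    split true  false true  true  true  {true} {v′} imp | true | refl = ℕ.≤-refl
    merge : ∀ v s t v′ s′ t′ {e e′} → e ≡ e′ →
      𝟙 ((v ∧ t ∧ not s) ∧ e ∧ not s′) + 𝟙 ((v′ ∧ t′ ∧ not s′) ∧ e′ ∧ s ∧ t) ≤ 𝟙 t * 𝟙 (e ∧ not s′)
    merge false s     t     false s′    t′    refl = z≤n
    merge false s     t     true  s′    false refl = z≤n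
    merge false s     t     true  true  true  refl = z≤n
    merge false s     t     true  false true  {false} refl = z≤n
    merge false false t     true  false true  {true} refl = z≤n
    merge false true  false true  false true  {true} refl = z≤n
    merge false true  true  true  false true  {true} refl = ℕ.≤-refl
    merge true  s     false false s′    t′    refl = z≤n
    merge true  s     false true  s′    false refl = z≤n
    merge true  s     false true  true  true  refl = z≤n
    merge true  s     false true  false true  {false} refl = z≤n
    merge true  false false true  false true  {true} refl = z≤n
    merge true  true  false true  false true  {true} refl = z≤n
    merge true  s     true  v′    s′    t′    {false} refl with s | v′ ∧ t′ ∧ not s′
    ... | false | false = z≤n
    ... | false | true  = z≤n
    ... | true  | false = z≤n
    ... | true  | true  = z≤n
    merge true  true  true  v′    false t′    {true} refl with v′ ∧ t′ ∧ true
    ... | false = z≤n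
    ... | true  = ℕ.≤-refl
    merge true  true  true  false true  t′    {true} refl = z≤n
    merge true  true  true  true  true  false {true} refl = z≤n
    merge true  true  true  true  true  true  {true} refl = z≤n
    merge true  false true  v′    false t′    {true} refl with v′ ∧ t′ ∧ true
    ... | false = ℕ.≤-refl
    ... | true  = ℕ.≤-refl
    merge true  false true  v′    true  t′    {true} refl with v′ ∧ t′ ∧ false
    ... | false = z≤n
    ... | true  = z≤n

  -- The sides agree at every vertex except where `S₀` and `T₀` overlap inside `V`; there `g` on the
  -- left meets `f` on the right.
  bounds-uncross : sumOver T₀ (λ x → 𝟙 (V x) * g x) + sumOver S f ≤ sumOver T₁ g + sumOver S₀ (λ x → 𝟙 (V x) * f x)
  bounds-uncross = subst₂ _≤_ (sumℕ-+ n _ _) (sumℕ-+ n _ _)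
    (sumℕ-mono-≤ (λ x → pointwise (V x) (S₀ x) (T₀ x) (g≤f x)))
    where
    pointwise : ∀ v s t {g f} → g ≤ f →
      𝟙 t * (𝟙 v * g) + 𝟙 (v ∧ s ∧ not t) * f ≤ 𝟙 (v ∧ t ∧ not s) * g + 𝟙 s * (𝟙 v * f)
    pointwise false s     false _ = z≤n
    pointwise false s     true  _ = z≤n
    pointwise true  false false _ = z≤n
    pointwise true  true  false {f = f} _ = ℕ.≤-reflexive (sym (ℕ.+-identityʳ (f + 0)))
    pointwise true  false true  {g} _ = ℕ.≤-reflexive (cong (_+ 0) (ℕ.+-identityʳ (g + 0)))
    pointwise true  true  true  {g} {f} g≤f = ℕ.≤-trans (ℕ.≤-reflexive (ℕ.+-identityʳ (g + 0 + 0)))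
      (ℕ.+-monoˡ-≤ 0 (ℕ.+-monoˡ-≤ 0 g≤f))

  -- A vertex discarded from `T₁` has degree at least `g`; on `T` the two sides agree. The sums are
  -- arranged to avoid subtraction.
  bounds-filter : sumOver T (degOutside E S) + sumOver T₁ g ≤ sumOver T g + sumOver T₁ (degOutside E S)
  bounds-filter = subst₂ _≤_ (sumℕ-+ n _ _) (sumℕ-+ n _ _)
    (sumℕ-mono-≤ (λ x → pointwise (T₁ x) (degOutside E S x ℕ.<? g x)))
    where
    pointwise : ∀ t {d g} (d<?g : Dec (d < g)) → 𝟙 (t ∧ does d<?g) * d + 𝟙 t * g ≤ 𝟙 (t ∧ does d<?g) * g + 𝟙 t * d
    pointwise false _         = z≤n
    pointwise true  (no d≮g)  = ℕ.+-monoˡ-≤ 0 (ℕ.≮⇒≥ d≮g)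
    pointwise true  {d} {g} (yes _) = ℕ.≤-reflexive (ℕ.+-comm (d + 0) (g + 0))

  uncross : Deficient E (λ x → 𝟙 (V x) * g x) (λ x → 𝟙 (V x) * f x) S₀ T₀ → Deficient E g f S T
  uncross deficient = combine deficient deg-uncross bounds-uncross bounds-filter
    where
    combine : ∀ {fS₀ dT₀ gT₀ fS dT₁ gT₁ dT gT} → fS₀ + dT₀ < gT₀ → dT₁ ≤ dT₀ → gT₀ + fS ≤ gT₁ + fS₀ →
      dT + gT₁ ≤ gT + dT₁ → fS + dT < gT
    combine {fS₀} {dT₀} {gT₀} {fS} {dT₁} {gT₁} {dT} {gT} p q r s =
      -- The four inequalities are added; the five intermediate quantities occur on both sides and
      -- cancel.
      ℕ.+-cancelʳ-≤ (fS₀ + dT₀ + gT₀ + dT₁ + gT₁) _ _ (subst₂ _≤_ (lhs fS₀ dT₀ gT₀ fS dT₁ gT₁ dT) (rhs fS₀ dT₀ gT₀ dT₁ gT₁ gT)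
        (ℕ.+-mono-≤ (ℕ.+-mono-≤ p q) (ℕ.+-mono-≤ r s)))
      where
      lhs : ∀ fS₀ dT₀ gT₀ fS dT₁ gT₁ dT → suc (fS₀ + dT₀) + dT₁ + (gT₀ + fS + (dT + gT₁)) ≡
        suc (fS + dT) + (fS₀ + dT₀ + gT₀ + dT₁ + gT₁)
      lhs = solve-∀
      rhs : ∀ fS₀ dT₀ gT₀ dT₁ gT₁ gT → gT₀ + dT₀ + (gT₁ + fS₀ + (gT + dT₁)) ≡
        gT + (fS₀ + dT₀ + gT₀ + dT₁ + gT₁)
      rhs = solve-∀

record Obstruction {n : ℕ} (V : Fin n → Bool) (E : Fin n → Fin n → Bool) (g f : Fin n → ℕ) : Set where
  field
    S T       : Fin n → Bool
    S⊆V       : ∀ x → S x ≡ true → V x ≡ true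
    T⊆V       : ∀ x → T x ≡ true → V x ≡ true
    disjoint  : ∀ x → T x ≡ true → S x ≡ false
    low       : ∀ x → T x ≡ true → degOutside E S x < g x
    deficient : Deficient E g f S T

-- Multiplying the bounds by the indicator of `V` gives the vertices outside `V` demand and capacity
-- zero. A bipartite factor `φ` becomes a fractional factor by averaging it with its transpose.
factor-or-obstruction : ∀ {n} {V : Fin n → Bool} {E : Fin n → Fin n → Bool} {g f : Fin n → ℕ} →
  (∀ x y → E x y ≡ E y x) → (∀ x y → E x y ≡ true → V y ≡ true) → (∀ x → g x ≤ f x) →
  HasFractionalFactor V E g f ⊎ Obstruction V E g f
factor-or-obstruction {n} {V} {E} {g} {f} E-sym E⊆V g≤f
  with DoubleCover.bipartite-factor E E-sym (λ x → 𝟙 (V x) * g x) (λ x → 𝟙 (V x) * f x) (λ x → ℕ.*-monoʳ-≤ (𝟙 (V x)) (g≤f x))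
... | inj₂ (S₀ , T₀ , def) = inj₂ record
  { S = S ; T = T
  ; S⊆V = λ x Sx → proj₁ (∧-true Sx)
  ; T⊆V = λ x Tx → proj₁ (∧-true (proj₁ (∧-true {T₁ x} Tx)))
  ; disjoint = λ x Tx → excluded (V x) (S₀ x) (T₀ x) (proj₁ (∧-true {T₁ x} Tx))
  ; low = λ x Tx → below (degOutside E S x ℕ.<? g x) (proj₂ (∧-true {T₁ x} Tx))
  ; deficient = uncross def }
  where
  open Uncrossing {n} {V} {E} E-sym E⊆V {g} {f} g≤f S₀ T₀
  excluded : ∀ v s t → v ∧ t ∧ not s ≡ true → v ∧ s ∧ not t ≡ false
  excluded true false true _ = refl
  below : ∀ {d k} (d<?k : Dec (d < k)) → does d<?k ≡ true → d < k
  below (yes d<k) _ = d<k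
... | inj₁ (φ , φ≤ , rows , cols) = inj₁ (h , (λ x y _ → cong half (ℕ.+-comm (φ x y) (φ y x))) , bounds , sums)
  where
  h : Fin n → Fin n → ℚ
  h x y = half (φ x y + φ y x)
  𝟙≤1 : ∀ b → 𝟙 b ≤ 1
  𝟙≤1 false = z≤n
  𝟙≤1 true  = ℕ.≤-refl
  φ≤1 : ∀ x y → φ x y ≤ 1
  φ≤1 x y = ℕ.≤-trans (φ≤ x y) (𝟙≤1 (E x y))
  bounds : ∀ x y → E x y ≡ true → (0ℚ ℚ.≤ h x y) × (h x y ℚ.≤ 1ℚ)
  bounds x y _ = half-mono-≤ {0} {φ x y + φ y x} z≤n , half-mono-≤ {φ x y + φ y x} {2} (ℕ.+-mono-≤ (φ≤1 x y) (φ≤1 y x))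
  on-edges : ∀ x y → (if E x y then h x y else 0ℚ) ≡ h x y
  on-edges x y with E x y in eq
  ... | true  = refl
  ... | false = sym (cong half (cong₂ _+_ (zero-off eq) (zero-off (trans (E-sym y x) eq))))
    where
    zero-off : ∀ {x y} → E x y ≡ false → φ x y ≡ 0
    zero-off {x} {y} off = ℕ.n≤0⇒n≡0 (subst (λ e → φ x y ≤ 𝟙 e) off (φ≤ x y))
  total-at : ∀ x → sumℚ (λ y → if E x y then h x y else 0ℚ) ≡ half (sumℕ (φ x) + sumℕ (λ y → φ y x))
  total-at x = trans (sumℚ-cong (on-edges x)) (trans (sumℚ-half n _) (cong half (sumℕ-+ n _ _)))
  sums : ∀ x → V x ≡ true →
    (ℕtoℚ (g x) ℚ.≤ sumℚ (λ y → if E x y then h x y else 0ℚ)) × (sumℚ (λ y → if E x y then h x y else 0ℚ) ℚ.≤ ℕtoℚ (f x))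
  sums x Vx rewrite total-at x =
    subst (ℚ._≤ _) (half-double (g x)) (half-mono-≤ (ℕ.+-mono-≤ (inside-≥ (proj₁ (rows x))) (inside-≥ (proj₁ (cols x))))) ,
    subst (_ ℚ.≤_) (half-double (f x)) (half-mono-≤ (ℕ.+-mono-≤ (inside-≤ (proj₂ (rows x))) (inside-≤ (proj₂ (cols x)))))
    where
    inside : ∀ k → 𝟙 (V x) * k ≡ k
    inside k rewrite Vx = ℕ.+-identityʳ k
    inside-≥ : ∀ {k j} → 𝟙 (V x) * k ≤ j → k ≤ j
    inside-≥ {k} {j} = subst (_≤ j) (inside k)
    inside-≤ : ∀ {k j} → j ≤ 𝟙 (V x) * k → j ≤ k
    inside-≤ {k} {j} = subst (j ≤_) (inside k)

-- Arithmetic of the deficiency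

-- Each contradiction below is a combination of the hypotheses with nonnegative coefficients whose
-- left side exceeds its right side; the excess is the last summand in the respective identity.
excess-absurd : ∀ {x y z} → 0 < z → x ≤ y → x ≡ y + z → ⊥
excess-absurd {y = y} {suc z} _ x≤y refl = ℕ.m+1+n≰m y x≤y

factor-pos : ∀ {x} B t → x < B * t → 0 < t
factor-pos B zero    p rewrite ℕ.*-zeroʳ B = ⊥-elim (ℕ.n≮0 p)
factor-pos B (suc t) p = z<s

T-large : ∀ {b c B s t D} → c ≤ b → s * c + D < B * t →
  t * (b * B) ≤ c * D + t * (c * s) → D + t ≤ B * t → b < t
T-large {b} {c} {B} {s} {t} {D} c≤b I V D≤ = ℕ.≰⇒> t≰b
  where
  t>0 : 0 < t
  t>0 = factor-pos B t I
  t≰b : ¬ t ≤ b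
  t≰b t≤b with ℕ.≤-total c t
  -- `i` and `j` name the differences, so that the excess is a polynomial with nonnegative
  -- coefficients.
  ... | inj₁ c≤t with i , refl ← ℕ.m≤n⇒∃[o]m+o≡n c≤t | j , refl ← ℕ.m≤n⇒∃[o]m+o≡n t≤b =
    excess-absurd (ℕ.m≤n⇒m≤n+o _ t>0) (ℕ.+-mono-≤ V (ℕ.*-monoʳ-≤ t I)) (identity B c s D i j)
    where
    identity : ∀ B c s D i j →
      (c + i) * ((c + i + j) * B) + (c + i) * suc (s * c + D) ≡
      (c * D + (c + i) * (c * s) + (c + i) * (B * (c + i))) + ((c + i) + ((c + i) * (j * B) + i * D))
    identity = solve-∀
  ... | inj₂ t≤c with i , refl ← ℕ.m≤n⇒∃[o]m+o≡n t≤c | j , refl ← ℕ.m≤n⇒∃[o]m+o≡n c≤b =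
    excess-absurd (ℕ.m≤n⇒m≤n+o _ t>0) (ℕ.+-mono-≤ (ℕ.+-mono-≤ V (ℕ.*-monoʳ-≤ t I)) (ℕ.*-monoʳ-≤ i D≤)) (identity B t s D i j)
    where
    identity : ∀ B t s D i j →
      t * ((t + i + j) * B) + t * suc (s * (t + i) + D) + i * (D + t) ≡
      ((t + i) * D + t * ((t + i) * s) + t * (B * t) + i * (B * t)) + (t + (t * (j * B) + i * t))
    identity = solve-∀

-- Suppose `B t ≤ Q`. With weight `t - c` on this, and `t` on the deficiency and on `Q ≤ D + 2 m`,
-- the terms in `s`, `D` and `Q` cancel against the averaged degree condition. The excess is
-- `t + t B (b - c) + t m (c - 2)`.
Q-small : ∀ {b c B m s t D Q} → 2 ≤ c → c ≤ b → b < t → s * c + D < B * t →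
  t * (b * B + c * m) ≤ c * Q + t * (c * s) → Q ≤ D + 2 * m → Q < B * t
Q-small {b} {c} {B} {m} {s} {t} {D} {Q} 2≤c c≤b b<t I V Q≤ = ℕ.≰⇒> λ Bt≤Q → contra Bt≤Q
  where
  t>0 : 0 < t
  t>0 = ℕ.≤-<-trans z≤n b<t
  contra : B * t ≤ Q → ⊥
  contra Bt≤Q with h , refl ← ℕ.m≤n⇒∃[o]m+o≡n 2≤c | i , refl ← ℕ.m≤n⇒∃[o]m+o≡n c≤b
    | j , refl ← ℕ.m≤n⇒∃[o]m+o≡n (ℕ.≤-trans c≤b (ℕ.<⇒≤ b<t)) =
    excess-absurd (ℕ.m≤n⇒m≤n+o _ t>0)
      (ℕ.+-mono-≤ (ℕ.+-mono-≤ V (ℕ.*-monoʳ-≤ t I)) (ℕ.+-mono-≤ (ℕ.*-monoʳ-≤ t Q≤) (ℕ.*-monoʳ-≤ j Bt≤Q)))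
      (identity B m s D Q h i j)
    where
    identity : ∀ B m s D Q h i j →
      (2 + h + j) * ((2 + h + i) * B + (2 + h) * m) + (2 + h + j) * suc (s * (2 + h) + D)
        + ((2 + h + j) * Q + j * (B * (2 + h + j))) ≡
      ((2 + h) * Q + (2 + h + j) * ((2 + h) * s) + (2 + h + j) * (B * (2 + h + j))
        + ((2 + h + j) * (D + 2 * m) + j * Q))
        + ((2 + h + j) + ((2 + h + j) * (B * i) + (2 + h + j) * (m * h)))
    identity = solve-∀

-- Weights `2 A` on the deficiency, `c` on the condition for the pair and `2 B` on the order
-- condition cancel `N` and `s`; then a factor `A` divides out.
T-vs-pair : ∀ {B c A A′ N m s t D P} → s * c + D < B * t → 2 * (N * B) ≤ (2 * s + P) * A →
  0 < B → (A′ + 2 * m) * A < N * c →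
  2 * D + 2 + 2 * B * (A′ + 2 * m) < 2 * B * t + c * P
T-vs-pair {B} {c} {A} {A′} {N} {m} {s} {t} {D} {P} I II B>0 III = ℕ.*-cancelˡ-< A _ _ (ℕ.+-cancelʳ-< (2 * (c * N * B) + 2 * (c * s * A)) _ _
  -- The slack `2 B` from the strict order condition makes the conclusion strict; the strictness of
  -- the deficiency supplies the `+ 2`.
  (ℕ.<-≤-trans (ℕ.m<m+n _ (ℕ.m≤n⇒m≤n+o B B>0))
    (subst₂ _≤_ (lhs B c A A′ N m s D) (rhs B c A N s t P)
      (ℕ.+-mono-≤ (ℕ.+-mono-≤ (ℕ.*-monoʳ-≤ (2 * B) III) (ℕ.*-monoʳ-≤ c II)) (ℕ.*-monoʳ-≤ (2 * A) I)))))
  where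
  lhs : ∀ B c A A′ N m s D →
    2 * B * suc ((A′ + 2 * m) * A) + c * (2 * (N * B)) + 2 * A * suc (s * c + D) ≡
    (A * (2 * D + 2 + 2 * B * (A′ + 2 * m)) + (2 * (c * N * B) + 2 * (c * s * A))) + (B + B)
  lhs = solve-∀
  rhs : ∀ B c A N s t P →
    2 * B * (N * c) + c * ((2 * s + P) * A) + 2 * A * (B * t) ≡
    A * (2 * B * t + c * P) + (2 * (c * N * B) + 2 * (c * s * A))
  rhs = solve-∀

-- Twice the deficiency and `2 B` times `s + t ≤ N` are added to the condition for the pair. `N` and
-- `t` cancel, and so does `s` since `A = B + c`.
D-vs-pair : ∀ {B c A N s t D P} → A ≡ B + c → s * c + D < B * t → 2 * (N * B) ≤ (2 * s + P) * A →
  s + t ≤ N → 2 * D + 2 ≤ P * A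
D-vs-pair {B} {c} {_} {N} {s} {t} {D} {P} refl I II s+t≤N = ℕ.+-cancelʳ-≤ (2 * (N * B) + 2 * (B * (s + t)) + 2 * (s * c)) _ _
  (subst₂ _≤_ (lhs B c N s t D) (rhs B c N s t P)
    (ℕ.+-mono-≤ (ℕ.+-mono-≤ II (ℕ.*-monoʳ-≤ (2 * B) s+t≤N)) (ℕ.*-monoʳ-≤ 2 I)))
  where
  lhs : ∀ B c N s t D → 2 * (N * B) + 2 * B * (s + t) + 2 * suc (s * c + D) ≡
    2 * D + 2 + (2 * (N * B) + 2 * (B * (s + t)) + 2 * (s * c))
  lhs = solve-∀
  rhs : ∀ B c N s t P → (2 * s + P) * (B + c) + 2 * B * N + 2 * (B * t) ≡
    P * (B + c) + (2 * (N * B) + 2 * (B * (s + t)) + 2 * (s * c))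
  rhs = solve-∀

cancel-+2 : ∀ {A′ B h} → A′ + 2 ≡ B + (2 + h) → A′ ≡ B + h
cancel-+2 {A′} {B} {h} eq = ℕ.+-cancelʳ-≡ 2 A′ (B + h) (trans eq (move B h))
  where
  move : ∀ B h → B + (2 + h) ≡ B + h + 2
  move = solve-∀

-- The last premise bounds `2 B t` from below. Of this, `2 q₁ t` is at most `2 D + 4 m` and the rest
-- at most `2 (B - q₁) (2 q₁ + 1)`, which is too little, given `q₂ < B + m`.
heavy-pair-absurd : ∀ {b c B A′ m t D Q q₁ q₂} → 2 ≤ c → c ≤ b → A′ + 2 ≡ B + c → b < t → t ≤ 2 * q₁ + 1 →
  q₁ < B → q₂ < B + m → q₁ * t ≤ Q → Q ≤ D + 2 * m →
  2 * D + 2 + 2 * B * (A′ + 2 * m) < 2 * B * t + c * (q₁ + q₂) → ⊥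
-- Here `t ≤ 1`, against `2 ≤ c ≤ b < t`.
heavy-pair-absurd {q₁ = zero} 2≤c c≤b _ b<t t≤ _ _ _ _ _ = ℕ.n≮0 (ℕ.≤-pred (ℕ.<-≤-trans (ℕ.≤-<-trans (ℕ.≤-trans 2≤c c≤b) b<t) t≤))
heavy-pair-absurd {b} {c} {B} {A′} {m} {t} {D} {Q} {q₁@(suc q)} {q₂} 2≤c c≤b A′≡ b<t t≤ q₁<B q₂< q₁t≤ Q≤ F
  with h , refl ← ℕ.m≤n⇒∃[o]m+o≡n 2≤c | y , refl ← ℕ.m≤n⇒∃[o]m+o≡n q₁<B
  with refl ← cancel-+2 {A′} {B} {h} A′≡ =
  excess-absurd z<s
    (ℕ.+-mono-≤ (ℕ.+-mono-≤ (ℕ.+-mono-≤ F (ℕ.*-monoʳ-≤ 2 (ℕ.≤-trans q₁t≤ Q≤))) (ℕ.*-monoʳ-≤ c q₂<))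
      (ℕ.+-mono-≤ (ℕ.*-monoʳ-≤ m c+2≤2B) (ℕ.*-monoʳ-≤ (2 * suc y) t≤)))
    (identity q y h m t D q₂)
  where
  -- `c ≤ b < t ≤ 2 q₁ + 1` gives `c ≤ 2 q₁`, and `q₁ < B`. The bound absorbs the term `c m` that
  -- comes from `q₂ < B + m`.
  c+2≤2B : c + 2 ≤ 2 * B
  c+2≤2B = ℕ.≤-trans (ℕ.+-monoˡ-≤ 2 (ℕ.≤-trans c≤b (ℕ.≤-pred (ℕ.≤-trans b<t (ℕ.≤-trans t≤ (ℕ.≤-reflexive (ℕ.+-comm (2 * q₁) 1)))))))
    (ℕ.≤-trans (ℕ.m≤m+n _ (2 * y)) (ℕ.≤-reflexive (double q y)))
    where
    double : ∀ q y → 2 * suc q + 2 + 2 * y ≡ 2 * (suc (suc q) + y)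
    double = solve-∀
  identity : ∀ q y h m t D q₂ →
    suc (2 * D + 2 + 2 * (suc (suc q) + y) * (suc (suc q) + y + h + 2 * m)) + 2 * (suc q * t) + (2 + h) * suc q₂
      + (m * (2 + h + 2) + 2 * suc y * t) ≡
    (2 * (suc (suc q) + y) * t + (2 + h) * (suc q + q₂) + 2 * (D + 2 * m) + (2 + h) * (suc (suc q) + y + m)
      + (m * (2 * (suc (suc q) + y)) + 2 * suc y * (2 * suc q + 1)))
      + suc (2 * (q * q) + 2 * (y * y) + h * (y + 2) + 2 * (m * suc (q + y)))
  identity = solve-∀

-- Weights `1`, `2 B` and `B - 1` on `F₁`, the bound on `t` and `F₂` cancel `t`, `m` and `D`.
unit-pair-absurd : ∀ {c B A A′ m t D} → 2 ≤ c → 2 ≤ B → A ≡ B + c → A′ + 2 ≡ B + c → t ≤ D + 1 + 2 * m →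
  2 * D + 2 ≤ 1 * A → 2 * D + 2 + 2 * B * (A′ + 2 * m) < 2 * B * t + c * 1 → ⊥
unit-pair-absurd {c} {B} {A} {A′} {m} {t} {D} 2≤c 2≤B refl A′≡ t≤ F₂ F₁
  with h , refl ← ℕ.m≤n⇒∃[o]m+o≡n 2≤c | y , refl ← ℕ.m≤n⇒∃[o]m+o≡n 2≤B
  with refl ← cancel-+2 {A′} {B} {h} A′≡ =
  excess-absurd z<s (ℕ.+-mono-≤ (ℕ.+-mono-≤ F₁ (ℕ.*-monoʳ-≤ (2 * B) t≤)) (ℕ.*-monoʳ-≤ (1 + y) F₂)) (identity y h m t D)
  where
  identity : ∀ y h m t D →
    suc (2 * D + 2 + 2 * (2 + y) * (2 + y + h + 2 * m)) + 2 * (2 + y) * t + (1 + y) * (2 * D + 2) ≡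
    (2 * (2 + y) * t + (2 + h) * 1 + 2 * (2 + y) * (D + 1 + 2 * m) + (1 + y) * (1 * (2 + y + (2 + h))))
      + suc ((2 + y) * (1 + y + h))
  identity = solve-∀

-- `P t ≤ 2 Q` and `Q < B t` give `P < 2 B`. With `W = 2 B` and `R = W - P`, weights `P` on twice
-- `F₁`, `2 W` on `P t ≤ 2 D + 4 m` and `R` on twice `F₂` cancel `t` and `D`. The excess is
-- `2 P + W (P - 2) (P - 2) + 4 m W (P - 2)`, positive for `P ≥ 2`.
light-pair-absurd : ∀ {c B A A′ m t D Q P} → 2 ≤ c → A ≡ B + c → A′ + 2 ≡ B + c → 2 ≤ P →
  P * t ≤ 2 * Q → Q ≤ D + 2 * m → Q < B * t →
  2 * D + 2 ≤ P * A → 2 * D + 2 + 2 * B * (A′ + 2 * m) < 2 * B * t + c * P → ⊥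
light-pair-absurd {c} {B} {A} {A′} {m} {t} {D} {Q} {P} 2≤c refl A′≡ 2≤P Pt≤ Q≤ Q< F₂ F₁
  with h , refl ← ℕ.m≤n⇒∃[o]m+o≡n 2≤c | p , refl ← ℕ.m≤n⇒∃[o]m+o≡n 2≤P
  with refl ← cancel-+2 {A′} {B} {h} A′≡ =
  contra (2 * B) (ℕ.m≤n⇒∃[o]m+o≡n P≤2B)
    (ℕ.≤-trans (ℕ.≤-reflexive (l₁ B h m D)) (ℕ.≤-trans (ℕ.*-monoʳ-≤ 2 F₁) (ℕ.≤-reflexive (r₁ B h t p))))
    (ℕ.≤-trans (ℕ.≤-reflexive (l₂ D)) (ℕ.≤-trans (ℕ.*-monoʳ-≤ 2 F₂) (ℕ.≤-reflexive (r₂ B h p))))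
  where
  Pt≤′ : P * t ≤ 2 * D + 4 * m
  Pt≤′ = ℕ.≤-trans Pt≤ (ℕ.≤-trans (ℕ.*-monoʳ-≤ 2 Q≤) (ℕ.≤-reflexive (expand D m)))
    where
    expand : ∀ D m → 2 * (D + 2 * m) ≡ 2 * D + 4 * m
    expand = solve-∀
  P≤2B : P ≤ 2 * B
  P≤2B = ℕ.<⇒≤ (ℕ.*-cancelʳ-< t P (2 * B)
    (ℕ.≤-<-trans Pt≤ (ℕ.<-≤-trans (ℕ.*-monoʳ-< 2 Q<) (ℕ.≤-reflexive (sym (ℕ.*-assoc 2 B t))))))
  l₁ : ∀ B h m D → suc (suc (4 * D + 4 + 2 * B * (2 * B + 2 * h + 4 * m))) ≡ 2 * suc (2 * D + 2 + 2 * B * (B + h + 2 * m))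
  l₁ = solve-∀
  r₁ : ∀ B h t p → 2 * (2 * B * t + (2 + h) * (2 + p)) ≡ 2 * (2 * B * t) + 2 * ((2 + h) * (2 + p))
  r₁ = solve-∀
  l₂ : ∀ D → 4 * D + 4 ≡ 2 * (2 * D + 2)
  l₂ = solve-∀
  r₂ : ∀ B h p → 2 * ((2 + p) * (B + (2 + h))) ≡ (2 + p) * (2 * B + 2 * (2 + h))
  r₂ = solve-∀
  -- Stated in W = 2B, so that 2B − P can be introduced as R without subtraction.
  contra : ∀ W → ∃ (λ R → 2 + p + R ≡ W) →
    suc (suc (4 * D + 4 + W * (W + 2 * h + 4 * m))) ≤ 2 * (W * t) + 2 * ((2 + h) * (2 + p)) →
    4 * D + 4 ≤ (2 + p) * (W + 2 * (2 + h)) → ⊥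
  contra W (R , refl) F₁′ F₂′ = excess-absurd z<s
    (ℕ.+-mono-≤ (ℕ.+-mono-≤ (ℕ.*-monoʳ-≤ (2 + p) F₁′) (ℕ.*-monoʳ-≤ (2 * W) Pt≤′)) (ℕ.*-monoʳ-≤ R F₂′))
    (identity R p h m t D)
    where
    identity : ∀ R p h m t D →
      (2 + p) * suc (suc (4 * D + 4 + (2 + p + R) * (2 + p + R + 2 * h + 4 * m)))
        + 2 * (2 + p + R) * ((2 + p) * t) + R * (4 * D + 4) ≡
      ((2 + p) * (2 * ((2 + p + R) * t) + 2 * ((2 + h) * (2 + p)))
        + 2 * (2 + p + R) * (2 * D + 4 * m) + R * ((2 + p) * (2 + p + R + 2 * (2 + h))))
        + suc (3 + 2 * p + (2 + p + R) * (p * p) + 4 * (m * ((2 + p + R) * p)))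
    identity = solve-∀

-- Counting in the graph

term≤sumℕ : ∀ {n} (f : Fin n → ℕ) i → f i ≤ sumℕ f
term≤sumℕ f fzero    = ℕ.m≤m+n _ _
term≤sumℕ f (fsuc i) = ℕ.m≤n⇒m≤o+n (f fzero) (term≤sumℕ (λ i → f (fsuc i)) i)

count-+ : ∀ n (p q : Fin n → Bool) → count p + count q ≡ sumℕ (λ i → 𝟙 (p i) + 𝟙 (q i))
count-+ n p q = trans (cong₂ _+_ (count≡sumℕ p) (count≡sumℕ q)) (sym (sumℕ-+ n _ _))

count-none : ∀ {n} (p : Fin n → Bool) → (∀ i → p i ≡ false) → count p ≡ 0
count-none {n} p none = trans (count≡sumℕ p) (trans (sumℕ-cong (λ i → cong 𝟙 (none i))) (sumℕ-0 n))

count-∣∣ : ∀ {n} (U : Subset n) → ∣ U ∣ ≡ count (lookup U)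
count-∣∣ []          = refl
count-∣∣ (true  ∷ U) = cong suc (count-∣∣ U)
count-∣∣ (false ∷ U) = count-∣∣ U

count-outside : ∀ {n} (U : Subset n) → n ≡ ∣ U ∣ + count (outside U)
count-outside []          = refl
count-outside (true  ∷ U) = cong suc (count-outside U)
count-outside (false ∷ U) = trans (cong suc (count-outside U)) (sym (ℕ.+-suc ∣ U ∣ _))

count-split : ∀ {n} (p q : Fin n → Bool) → count p ≡ count (λ x → p x ∧ q x) + count (λ x → p x ∧ not (q x))
count-split {n} p q = trans (count≡sumℕ p) (trans (sumℕ-cong (λ x → split (p x) (q x))) (sym (count-+ n _ _)))
  where
  split : ∀ p q → 𝟙 p ≡ 𝟙 (p ∧ q) + 𝟙 (p ∧ not q)
  split false q     = refl
  split true  false = refl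
  split true  true  = refl

sumOver-mono-≤ : ∀ {n} (p : Fin n → Bool) {v w : Fin n → ℕ} → (∀ x → p x ≡ true → v x ≤ w x) → sumOver p v ≤ sumOver p w
sumOver-mono-≤ p {v} {w} v≤w = sumℕ-mono-≤ pointwise
  where
  pointwise : ∀ x → 𝟙 (p x) * v x ≤ 𝟙 (p x) * w x
  pointwise x with p x in px
  ... | false = z≤n
  ... | true  = ℕ.+-monoˡ-≤ 0 (v≤w x px)

sumOver-const : ∀ {n} (p : Fin n → Bool) k → sumOver p (λ _ → k) ≡ k * count p
sumOver-const {n} p k = trans (sumℕ-cong (λ x → ℕ.*-comm (𝟙 (p x)) k))
  (trans (sumℕ-*ˡ n k _) (cong (k *_) (sym (count≡sumℕ p))))

sumOver-+ : ∀ {n} (p : Fin n → Bool) (v w : Fin n → ℕ) → sumOver p (λ x → v x + w x) ≡ sumOver p v + sumOver p w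
sumOver-+ {n} p v w = trans (sumℕ-cong (λ x → ℕ.*-distribˡ-+ (𝟙 (p x)) (v x) (w x))) (sumℕ-+ n _ _)

sumOver-*ˡ : ∀ {n} (p : Fin n → Bool) k (v : Fin n → ℕ) → sumOver p (λ x → k * v x) ≡ k * sumOver p v
sumOver-*ˡ {n} p k v = trans (sumℕ-cong (λ x → swap (𝟙 (p x)) k (v x))) (sumℕ-*ˡ n k _)
  where
  swap : ∀ i j k → i * (j * k) ≡ j * (i * k)
  swap = solve-∀

sumOver≤sumℕ : ∀ {n} (p : Fin n → Bool) (v : Fin n → ℕ) → sumOver p v ≤ sumℕ v
sumOver≤sumℕ p v = sumℕ-mono-≤ (λ x → pointwise (p x) (v x))
  where
  pointwise : ∀ b k → 𝟙 b * k ≤ k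
  pointwise false k = z≤n
  pointwise true  k = ℕ.≤-reflexive (ℕ.+-identityʳ k)

argmin : ∀ {n} (p : Fin n → Bool) (v : Fin n → ℕ) →
  (∀ x → p x ≡ false) ⊎ ∃ λ x → p x ≡ true × ∀ y → p y ≡ true → v x ≤ v y
argmin {zero}  p v = inj₁ λ ()
argmin {suc n} p v with p fzero in p0 | argmin (λ i → p (fsuc i)) (λ i → v (fsuc i))
... | false | inj₁ none = inj₁ λ { fzero → p0 ; (fsuc i) → none i }
... | false | inj₂ (x , px , least) = inj₂ (fsuc x , px , λ
      { fzero p0′ → contradiction (trans (sym p0) p0′) (λ ()) ; (fsuc y) py → least y py })
... | true  | inj₁ none = inj₂ (fzero , p0 , λ
      { fzero _ → ℕ.≤-refl ; (fsuc y) py → contradiction (trans (sym (none y)) py) (λ ()) })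
... | true  | inj₂ (x , px , least) with ℕ.≤-total (v fzero) (v (fsuc x))
... | inj₁ v0≤ = inj₂ (fzero , p0 , λ { fzero _ → ℕ.≤-refl ; (fsuc y) py → ℕ.≤-trans v0≤ (least y py) })
... | inj₂ ≤v0 = inj₂ (fsuc x , px , λ { fzero _ → ≤v0 ; (fsuc y) py → least y py })

-- Degrees in the deleted edge set

module EdgeSet {n : ℕ} (H : Fin n → Fin n → Bool) (H-sym : ∀ x y → H x y ≡ H y x)
  (H-irrefl : ∀ x → H x x ≡ false) where

  -- As in `edgeCount`, an edge is recorded once, in the row of its smaller end.
  up : Fin n → Fin n → ℕ
  up x y = 𝟙 (H x y ∧ (toℕ x <ᵇ toℕ y))

  edgeCount-up : edgeCount H ≡ sumℕ (λ x → sumℕ (up x))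
  edgeCount-up = sumℕ-cong {n} (λ x → count≡sumℕ (λ y → H x y ∧ (toℕ x <ᵇ toℕ y)))

  up-irrefl : ∀ x → up x x ≡ 0
  up-irrefl x rewrite H-irrefl x = refl

  <ᵇ-true : ∀ {i j} → i < j → (i <ᵇ j) ≡ true
  <ᵇ-true {i} {j} i<j with i <ᵇ j | ℕ.<⇒<ᵇ i<j
  ... | true | _ = refl

  oriented : ∀ x y → 𝟙 (H x y) ≤ up x y + up y x
  oriented x y with ℕ.<-cmp (toℕ x) (toℕ y)
  ... | tri< x<y _ _ rewrite <ᵇ-true x<y | ∧-comm (H x y) true = ℕ.m≤m+n _ _
  ... | tri> _ _ y<x rewrite <ᵇ-true y<x | H-sym y x | ∧-comm (H x y) true = ℕ.m≤n+m _ _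
  ... | tri≈ _ x≡y _ with refl ← Fin.toℕ-injective x≡y rewrite H-irrefl x = z≤n

  degree-oriented : ∀ x → count (H x) ≤ sumℕ (up x) + sumℕ (λ y → up y x)
  degree-oriented x = ℕ.≤-trans (ℕ.≤-reflexive (count≡sumℕ (H x)))
    (ℕ.≤-trans (sumℕ-mono-≤ (oriented x)) (ℕ.≤-reflexive (sumℕ-+ n _ _)))

  handshake : sumℕ (λ x → count (H x)) ≤ 2 * edgeCount H
  handshake = begin
    sumℕ (λ x → count (H x))                                        ≤⟨ sumℕ-mono-≤ degree-oriented ⟩
    sumℕ (λ x → sumℕ (up x) + sumℕ (λ y → up y x))                  ≡⟨ sumℕ-+ n _ _ ⟩
    sumℕ (λ x → sumℕ (up x)) + sumℕ (λ x → sumℕ (λ y → up y x))     ≡⟨ cong (_+_ (sumℕ (λ x → sumℕ (up x)))) (sumℕ-swap n n up) ⟨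
    sumℕ (λ x → sumℕ (up x)) + sumℕ (λ x → sumℕ (up x))             ≡⟨ cong₂ _+_ edgeCount-up edgeCount-up ⟨
    edgeCount H + edgeCount H                                       ≡⟨ cong (_+_ (edgeCount H)) (ℕ.+-identityʳ (edgeCount H)) ⟨
    2 * edgeCount H                                                 ∎
    where open ℕ.≤-Reasoning

  -- The edges at `x` form row `x` of `up` and at most one entry, in column `x`, of every other row;
  -- the zero diagonal prevents double counting.
  degree≤edges : ∀ x → count (H x) ≤ edgeCount H
  degree≤edges x = begin
    count (H x)                                                     ≤⟨ degree-oriented x ⟩
    sumℕ (up x) + sumℕ (λ u → up u x)                               ≡⟨ cong (_+ sumℕ (λ u → up u x)) (sumℕ-single x (λ u → sumℕ (up u))) ⟨
    sumℕ (λ u → δ x u * sumℕ (up u)) + sumℕ (λ u → up u x)          ≡⟨ sumℕ-+ n _ _ ⟨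
    sumℕ (λ u → δ x u * sumℕ (up u) + up u x)                       ≤⟨ sumℕ-mono-≤ pointwise ⟩
    sumℕ (λ u → sumℕ (up u))                                        ≡⟨ edgeCount-up ⟨
    edgeCount H                                                     ∎
    where
    open ℕ.≤-Reasoning
    pointwise : ∀ u → δ x u * sumℕ (up u) + up u x ≤ sumℕ (up u)
    pointwise u with x Fin.≟ u
    ... | no _     = term≤sumℕ (up u) x
    ... | yes refl = ℕ.≤-reflexive (trans (cong (_+_ (sumℕ (up x) + 0)) (up-irrefl x))
      (trans (ℕ.+-identityʳ _) (ℕ.+-identityʳ _)))

-- Refuting an obstruction by the degree and order conditions

module Contradiction {n : ℕ} (G : Graph n) (b a n′ m Δ : ℕ) (g f : Fin n → ℕ)
  (2≤a : 2 ≤ a) (a+Δ≤b : a + Δ ≤ b)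
  (min-deg : ∀ x → b * (b ∸ Δ) + (m + n′) * (Δ + a) ≤ deg G x * (Δ + a))
  (order : (b + a + 2 * m ∸ 2) * (a + b) + n′ * (Δ + a) < n * (Δ + a))
  (bounds : ∀ x → (f x ≤ b) × (g x + Δ ≤ f x) × (a ≤ g x))
  (ore : ∀ u v → u ≢ v → adj G u v ≡ false →
    2 * (n * (b ∸ Δ) + n′ * (Δ + a)) ≤ (deg G u + deg G v) * (b + a))
  (U : Subset n) (∣U∣≡n′ : ∣ U ∣ ≡ n′)
  (H : Fin n → Fin n → Bool) (H-sym : ∀ x y → H x y ≡ H y x)
  (H⊆ : ∀ x y → H x y ≡ true → edgesMinus G U x y ≡ true)
  (∣H∣≡m : edgeCount H ≡ m)
  (obstruction : Obstruction (outside U) (λ x y → edgesMinus G U x y ∧ not (H x y)) g f) where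

  open Obstruction obstruction

  -- `N` is the order of `G - U`. The truncated subtractions in `B` and `A′` are exact, by `Δ≤b` and
  -- `2≤A`.
  B c A A′ N s t D Q : ℕ
  d e q : Fin n → ℕ

  B = b ∸ Δ
  c = Δ + a
  A = b + a
  A′ = A ∸ 2
  N = count (outside U)
  s = count S
  t = count T
  d = degOutside (λ x y → edgesMinus G U x y ∧ not (H x y)) S
  e x = count (H x)
  q x = d x + e x
  D = sumOver T d
  Q = sumOver T q

  c≤b : c ≤ b
  c≤b = ℕ.≤-trans (ℕ.≤-reflexive (ℕ.+-comm Δ a)) a+Δ≤b

  2≤c : 2 ≤ c
  2≤c = ℕ.≤-trans 2≤a (ℕ.m≤n+m a Δ)

  2≤B : 2 ≤ B
  2≤B = ℕ.≤-trans 2≤a (ℕ.m+n≤o⇒m≤o∸n a a+Δ≤b)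

  Δ≤b : Δ ≤ b
  Δ≤b = ℕ.≤-trans (ℕ.m≤n+m Δ a) a+Δ≤b

  A≡B+c : A ≡ B + c
  A≡B+c = trans (cong (_+ a) (sym (ℕ.m∸n+n≡m Δ≤b))) (ℕ.+-assoc B Δ a)

  2≤A : 2 ≤ A
  2≤A = ℕ.≤-trans 2≤a (ℕ.m≤n+m a b)

  A′+2≡B+c : A′ + 2 ≡ B + c
  A′+2≡B+c = trans (ℕ.m∸n+n≡m 2≤A) A≡B+c

  g≤B : ∀ x → g x ≤ B
  g≤B x = ℕ.m+n≤o⇒m≤o∸n (g x) (ℕ.≤-trans (proj₁ (proj₂ (bounds x))) (proj₁ (bounds x)))

  c≤f : ∀ x → c ≤ f x
  c≤f x = ℕ.≤-trans (ℕ.≤-reflexive (ℕ.+-comm Δ a))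
    (ℕ.≤-trans (ℕ.+-monoˡ-≤ Δ (proj₂ (proj₂ (bounds x)))) (proj₁ (proj₂ (bounds x))))

  d<B : ∀ x → T x ≡ true → d x < B
  d<B x Tx = ℕ.<-≤-trans (low x Tx) (g≤B x)

  H-irrefl : ∀ x → H x x ≡ false
  H-irrefl x with H x x in Hxx
  ... | false = refl
  ... | true  = contradiction (trans (sym (adj-irrefl G x)) (proj₁ (∧-true (H⊆ x x Hxx)))) (λ ())

  open EdgeSet H H-sym H-irrefl using (handshake; degree≤edges)

  e≤m : ∀ x → e x ≤ m
  e≤m x = ℕ.≤-trans (degree≤edges x) (ℕ.≤-reflexive ∣H∣≡m)

  Q≤D+2m : Q ≤ D + 2 * m
  Q≤D+2m = begin
    Q                    ≡⟨ sumOver-+ T d e ⟩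
    D + sumOver T e      ≤⟨ ℕ.+-monoʳ-≤ D (sumOver≤sumℕ T e) ⟩
    D + sumℕ e           ≤⟨ ℕ.+-monoʳ-≤ D handshake ⟩
    D + 2 * edgeCount H  ≡⟨ cong (λ k → D + 2 * k) ∣H∣≡m ⟩
    D + 2 * m            ∎
    where open ℕ.≤-Reasoning

  -- A neighbour of `x` lies in `U` or `S`, is joined to `x` by an edge of `H`, or is counted by
  -- `d x`; that `x` itself is outside `U` comes from `T⊆V`.
  deg≤ : ∀ x → T x ≡ true → deg G x ≤ n′ + s + q x
  deg≤ x Tx = begin
    deg G x                                                           ≡⟨ count≡sumℕ (adj G x) ⟩
    sumℕ (λ y → 𝟙 (adj G x y))                                        ≤⟨ sumℕ-mono-≤ (λ y → pointwise (adj G x y) (lookup U y) (S y) (H x y) (T⊆V x Tx)) ⟩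
    sumℕ (λ y → (𝟙 (lookup U y) + 𝟙 (S y)) + (𝟙 (kept y) + 𝟙 (H x y))) ≡⟨ sumℕ-+ n _ _ ⟩
    sumℕ (λ y → 𝟙 (lookup U y) + 𝟙 (S y)) + sumℕ (λ y → 𝟙 (kept y) + 𝟙 (H x y))
      ≡⟨ cong₂ _+_ (count-+ n (lookup U) S) (count-+ n kept (H x)) ⟨
    count (lookup U) + s + q x                                        ≡⟨ cong (λ k → k + s + q x) (trans (sym (count-∣∣ U)) ∣U∣≡n′) ⟩
    n′ + s + q x                                                      ∎
    where
    open ℕ.≤-Reasoning
    kept : Fin n → Bool
    kept y = (edgesMinus G U x y ∧ not (H x y)) ∧ not (S y)
    pointwise : ∀ a u s h {v} → v ≡ true → 𝟙 a ≤ (𝟙 u + 𝟙 s) + (𝟙 (((a ∧ v ∧ not u) ∧ not h) ∧ not s) + 𝟙 h)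
    pointwise false u     s     h     _    = z≤n
    pointwise true  true  s     h     _    = s≤s z≤n
    pointwise true  false true  h     _    = s≤s z≤n
    pointwise true  false false true  refl = s≤s z≤n
    pointwise true  false false false refl = s≤s z≤n

  -- The functions are replaced by their extreme values: `f` is at least `c` on `S` and `g` at most
  -- `B` on `T`.
  deficiency : s * c + D < B * t
  deficiency = begin-strict
    s * c + D               ≡⟨ cong (_+ D) (trans (ℕ.*-comm s c) (sym (sumOver-const S c))) ⟩
    sumOver S (λ _ → c) + D ≤⟨ ℕ.+-monoˡ-≤ D (sumOver-mono-≤ S (λ x _ → c≤f x)) ⟩
    sumOver S f + D         <⟨ deficient ⟩
    sumOver T g             ≤⟨ sumOver-mono-≤ T (λ x _ → g≤B x) ⟩
    sumOver T (λ _ → B)     ≡⟨ sumOver-const T B ⟩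
    B * t                   ∎
    where open ℕ.≤-Reasoning

  D+t≤Bt : D + t ≤ B * t
  D+t≤Bt = begin
    D + t                         ≡⟨ cong (_+_ D) (trans (sym (ℕ.*-identityˡ t)) (sym (sumOver-const T 1))) ⟩
    D + sumOver T (λ _ → 1)       ≡⟨ sumOver-+ T d (λ _ → 1) ⟨
    sumOver T (λ x → d x + 1)     ≤⟨ sumOver-mono-≤ T (λ x Tx → ℕ.≤-trans (ℕ.≤-reflexive (ℕ.+-comm (d x) 1)) (d<B x Tx)) ⟩
    sumOver T (λ _ → B)           ≡⟨ sumOver-const T B ⟩
    B * t                         ∎
    where open ℕ.≤-Reasoning

  degree-in-T : ∀ x → T x ≡ true → b * B + c * m ≤ c * q x + c * s
  degree-in-T x Tx = ℕ.+-cancelʳ-≤ (n′ * c) _ _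
    (subst₂ _≤_ (lhs b B m n′ c) (rhs n′ s (q x) c) (ℕ.≤-trans (min-deg x) (ℕ.*-monoˡ-≤ c (deg≤ x Tx))))
    where
    lhs : ∀ b B m n′ c → b * B + (m + n′) * c ≡ b * B + c * m + n′ * c
    lhs = solve-∀
    rhs : ∀ n′ s q c → (n′ + s + q) * c ≡ c * q + c * s + n′ * c
    rhs = solve-∀

  -- Kept general because it is applied twice: to `d` with the term in `m` cancelled, and to `q`
  -- with that term retained.
  sum-over-T : ∀ k (v : Fin n → ℕ) → (∀ x → T x ≡ true → k ≤ c * v x + c * s) → t * k ≤ c * sumOver T v + t * (c * s)
  sum-over-T k v k≤ = begin
    t * k                                               ≡⟨ ℕ.*-comm t k ⟩
    k * t                                               ≡⟨ sumOver-const T k ⟨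
    sumOver T (λ _ → k)                                 ≤⟨ sumOver-mono-≤ T k≤ ⟩
    sumOver T (λ x → c * v x + c * s)                   ≡⟨ sumOver-+ T (λ x → c * v x) (λ _ → c * s) ⟩
    sumOver T (λ x → c * v x) + sumOver T (λ _ → c * s) ≡⟨ cong₂ _+_ (sumOver-*ˡ T c v) (trans (sumOver-const T (c * s)) (ℕ.*-comm (c * s) t)) ⟩
    c * sumOver T v + t * (c * s)                       ∎
    where open ℕ.≤-Reasoning

  b<t : b < t
  b<t = T-large {b} {c} {B} {s} {t} {D} c≤b deficiency (sum-over-T (b * B) d without-H) D+t≤Bt
    where
    -- The at most `m` edges of `H` at `x` use up the summand `m` of the minimum degree condition.
    without-H : ∀ x → T x ≡ true → b * B ≤ c * d x + c * s
    without-H x Tx = ℕ.+-cancelʳ-≤ (c * m) _ _ (ℕ.≤-trans (degree-in-T x Tx)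
      (ℕ.≤-trans (ℕ.+-monoˡ-≤ (c * s) (ℕ.*-monoʳ-≤ c (ℕ.+-monoʳ-≤ (d x) (e≤m x)))) (ℕ.≤-reflexive (regroup c (d x) m s))))
      where
      regroup : ∀ c d m s → c * (d + m) + c * s ≡ c * d + c * s + c * m
      regroup = solve-∀

  Q<Bt : Q < B * t
  Q<Bt = Q-small {b} {c} {B} {m} {s} {t} {D} {Q} 2≤c c≤b b<t deficiency (sum-over-T (b * B + c * m) q degree-in-T) Q≤D+2m

  s+t≤N : s + t ≤ N
  s+t≤N = begin
    s + t                            ≡⟨ count-+ n S T ⟩
    sumℕ (λ x → 𝟙 (S x) + 𝟙 (T x))   ≤⟨ sumℕ-mono-≤ (λ x → pointwise (S x) (T x) (S⊆V x) (T⊆V x) (disjoint x)) ⟩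
    sumℕ (λ x → 𝟙 (outside U x))     ≡⟨ count≡sumℕ (outside U) ⟨
    N                                ∎
    where
    open ℕ.≤-Reasoning
    pointwise : ∀ s t {v} → (s ≡ true → v ≡ true) → (t ≡ true → v ≡ true) → (t ≡ true → s ≡ false) → 𝟙 s + 𝟙 t ≤ 𝟙 v
    pointwise false false _  _  _   = z≤n
    pointwise false true  _  tv _   rewrite tv refl = ℕ.≤-refl
    pointwise true  false sv _  _   rewrite sv refl = ℕ.≤-refl
    pointwise true  true  _  _  dis = contradiction (dis refl) (λ ())

  n≡n′+N : n ≡ n′ + N
  n≡n′+N = trans (count-outside U) (cong (_+ N) ∣U∣≡n′)

  large-order : (A′ + 2 * m) * A < N * c
  large-order = ℕ.+-cancelʳ-< (n′ * c) _ _ (subst₂ _<_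
    (cong (λ k → k + n′ * c) (cong₂ _*_ (ℕ.+-∸-comm (2 * m) 2≤A) (ℕ.+-comm a b)))
    (trans (cong (_* c) (trans n≡n′+N (ℕ.+-comm n′ N))) (ℕ.*-distribʳ-+ c N n′)) order)

  -- As `A = B + c` and `n = n′ + N`, the left side of `ore` is `2 (N B + n′ A)`. Its `n′ A` cancels
  -- against the neighbours in `U` allowed for by `deg≤`.
  nonadjacent-pair : ∀ u v → T u ≡ true → T v ≡ true → u ≢ v → adj G u v ≡ false →
    2 * (N * B) ≤ (2 * s + (q u + q v)) * A
  nonadjacent-pair u v Tu Tv u≢v uv = ℕ.+-cancelʳ-≤ (2 * (n′ * A)) _ _ (begin
    2 * (N * B) + 2 * (n′ * A)                        ≡⟨ cong (λ k → 2 * (N * B) + 2 * (n′ * k)) A≡B+c ⟩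
    2 * (N * B) + 2 * (n′ * (B + c))                  ≡⟨ lhs N B n′ c ⟩
    2 * ((n′ + N) * B + n′ * c)                       ≡⟨ cong (λ k → 2 * (k * B + n′ * c)) n≡n′+N ⟨
    2 * (n * B + n′ * c)                              ≤⟨ ore u v u≢v uv ⟩
    (deg G u + deg G v) * A                           ≤⟨ ℕ.*-monoˡ-≤ A (ℕ.+-mono-≤ (deg≤ u Tu) (deg≤ v Tv)) ⟩
    (n′ + s + q u + (n′ + s + q v)) * A               ≡⟨ rhs n′ s (q u) (q v) A ⟩
    (2 * s + (q u + q v)) * A + 2 * (n′ * A)          ∎)
    where
    open ℕ.≤-Reasoning
    lhs : ∀ N B n′ c → 2 * (N * B) + 2 * (n′ * (B + c)) ≡ 2 * ((n′ + N) * B + n′ * c)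
    lhs = solve-∀
    rhs : ∀ n′ s i j A → (n′ + s + i + (n′ + s + j)) * A ≡ (2 * s + (i + j)) * A + 2 * (n′ * A)
    rhs = solve-∀

  closed-nbr : Fin n → Fin n → Bool
  closed-nbr u y = does (u Fin.≟ y) ∨ adj G u y

  -- `T` avoids `U` and `S`, so each neighbour of `u` in `T` is counted in `d u` or in `e u`; the
  -- `1` is for `u` itself.
  closed-nbr-count : ∀ u → T u ≡ true → count (λ y → T y ∧ closed-nbr u y) ≤ q u + 1
  closed-nbr-count u Tu = begin
    count (λ y → T y ∧ closed-nbr u y)               ≡⟨ count≡sumℕ {n} _ ⟩
    sumℕ (λ y → 𝟙 (T y ∧ closed-nbr u y))
      ≤⟨ sumℕ-mono-≤ (λ y → pointwise (T y) (does (u Fin.≟ y)) (adj G u y) (H u y) (T⊆V u Tu) (T⊆V y) (disjoint y)) ⟩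
    sumℕ (λ y → (𝟙 (kept y) + 𝟙 (H u y)) + δ u y)    ≡⟨ sumℕ-+ n _ _ ⟩
    sumℕ (λ y → 𝟙 (kept y) + 𝟙 (H u y)) + sumℕ (δ u) ≡⟨ cong₂ _+_ (sym (count-+ n kept (H u))) sum-δ ⟩
    q u + 1                                          ∎
    where
    open ℕ.≤-Reasoning
    kept : Fin n → Bool
    kept y = (edgesMinus G U u y ∧ not (H u y)) ∧ not (S y)
    sum-δ : sumℕ (δ u) ≡ 1
    sum-δ = trans (sumℕ-cong (λ y → sym (ℕ.*-identityʳ (δ u y)))) (sumℕ-single u (λ _ → 1))
    pointwise : ∀ t i a h {v v′ s} → v ≡ true → (t ≡ true → v′ ≡ true) → (t ≡ true → s ≡ false) →
      𝟙 (t ∧ (i ∨ a)) ≤ (𝟙 (((a ∧ v ∧ v′) ∧ not h) ∧ not s) + 𝟙 h) + 𝟙 i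
    pointwise false i     a     h     _    _  _   = z≤n
    pointwise true  true  a     h     _    _  _   = ℕ.m≤n+m 1 _
    pointwise true  false false h     _    _  _   = z≤n
    pointwise true  false true  true  _    _  _   = ℕ.≤-trans (ℕ.m≤n+m 1 _) (ℕ.m≤m+n _ 0)
    pointwise true  false true  false refl tv dis rewrite tv refl | dis refl = ℕ.≤-refl

  module MinimalVertex (u : Fin n) (Tu : T u ≡ true) (u-least : ∀ y → T y ≡ true → q u ≤ q y) where

    W : Fin n → Bool
    W y = T y ∧ not (closed-nbr u y)

    k k₂ : ℕ
    k = count (λ y → T y ∧ closed-nbr u y)
    k₂ = count W

    t≡k+k₂ : t ≡ k + k₂
    t≡k+k₂ = count-split T (closed-nbr u)

    qt≤Q : q u * t ≤ Q
    qt≤Q = ℕ.≤-trans (ℕ.≤-reflexive (sym (sumOver-const T (q u)))) (sumOver-mono-≤ T u-least)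

    -- The least value of `q` on `T` is at most its average, which is below `B`.
    q<B : q u < B
    q<B = ℕ.*-cancelʳ-< t (q u) B (ℕ.≤-<-trans qt≤Q Q<Bt)

    T-not-clique : ¬ (∀ y → W y ≡ false)
    T-not-clique none = ℕ.<-irrefl refl (begin-strict
      b       <⟨ b<t ⟩
      t       ≡⟨ trans t≡k+k₂ (trans (cong (_+_ k) (count-none W none)) (ℕ.+-identityʳ k)) ⟩
      k       ≤⟨ closed-nbr-count u Tu ⟩
      q u + 1 ≡⟨ ℕ.+-comm (q u) 1 ⟩
      suc (q u) ≤⟨ q<B ⟩
      B       ≤⟨ ℕ.m∸n≤m b Δ ⟩
      b       ∎)
      where open ℕ.≤-Reasoning

    module Pair (v : Fin n) (Wv : W v ≡ true) (v-least : ∀ y → W y ≡ true → q v ≤ q y) where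

      P : ℕ
      P = q u + q v

      Tv : T v ≡ true
      Tv = proj₁ (∧-true Wv)

      qu≤qv : q u ≤ q v
      qu≤qv = u-least v Tv

      not-closed : ∀ {i a} → not (i ∨ a) ≡ true → i ≡ false × a ≡ false
      not-closed {false} {false} _ = refl , refl

      u≢v : u ≢ v
      u≢v u≡v with u Fin.≟ v | proj₁ (not-closed {does (u Fin.≟ v)} (proj₂ (∧-true {T v} Wv)))
      ... | no ≢ | _ = ≢ u≡v

      II : 2 * (N * B) ≤ (2 * s + P) * A
      II = nonadjacent-pair u v Tu Tv u≢v (proj₂ (not-closed {does (u Fin.≟ v)} (proj₂ (∧-true {T v} Wv))))

      F₁ : 2 * D + 2 + 2 * B * (A′ + 2 * m) < 2 * B * t + c * P
      F₁ = T-vs-pair {B} {c} {A} {A′} {N} {m} {s} {t} {D} {P} deficiency II (ℕ.<-trans z<s 2≤B) large-order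

      F₂ : 2 * D + 2 ≤ P * A
      F₂ = D-vs-pair {B} {c} {A} {N} {s} {t} {D} {P} A≡B+c deficiency II s+t≤N

      Q≥ : q u * k + q v * k₂ ≤ Q
      Q≥ = begin
        q u * k + q v * k₂
          ≡⟨ cong₂ _+_ (sumOver-const K (q u)) (sumOver-const W (q v)) ⟨
        sumOver K (λ _ → q u) + sumOver W (λ _ → q v)
          ≤⟨ ℕ.+-mono-≤ (sumOver-mono-≤ K (λ y Ky → u-least y (proj₁ (∧-true Ky)))) (sumOver-mono-≤ W v-least) ⟩
        sumOver K q + sumOver W q
          ≡⟨ sumℕ-+ n _ _ ⟨
        sumℕ (λ y → 𝟙 (K y) * q y + 𝟙 (W y) * q y)
          ≡⟨ sumℕ-cong (λ y → merge (T y) (closed-nbr u y) (q y)) ⟩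
        Q ∎
        where
        open ℕ.≤-Reasoning
        K : Fin n → Bool
        K y = T y ∧ closed-nbr u y
        merge : ∀ t i j → 𝟙 (t ∧ i) * j + 𝟙 (t ∧ not i) * j ≡ 𝟙 t * j
        merge false i     j = refl
        merge true  false j = refl
        merge true  true  j = ℕ.+-identityʳ _

      k≤ : k ≤ q u + 1
      k≤ = closed-nbr-count u Tu

      q-sum-one : q u + q v ≡ 1 → q u ≡ 0 × q v ≡ 1
      q-sum-one eq with q u | q v | qu≤qv
      q-sum-one refl | zero        | suc zero | _ = refl , refl
      q-sum-one ()   | suc zero    | suc _    | _
      q-sum-one ()   | suc (suc _) | _        | _

      -- Here `q u = 0` leaves at most `u` in its closed neighbourhood, and each vertex of `W` adds
      -- at least `q v = 1` to `Q`.
      t-if-one : P ≡ 1 → t ≤ D + 1 + 2 * m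
      t-if-one P≡1 with q-sum-one P≡1
      ... | qu≡0 , qv≡1 = begin
        t                 ≡⟨ t≡k+k₂ ⟩
        k + k₂            ≤⟨ ℕ.+-mono-≤ (subst (λ i → k ≤ i + 1) qu≡0 k≤) (ℕ.≤-trans k₂≤Q Q≤D+2m) ⟩
        1 + (D + 2 * m)   ≡⟨ regroup D m ⟩
        D + 1 + 2 * m     ∎
        where
        open ℕ.≤-Reasoning
        k₂≤Q : k₂ ≤ Q
        k₂≤Q = ℕ.≤-trans (ℕ.≤-reflexive (sym (ℕ.+-identityʳ k₂)))
          (subst₂ (λ i j → i * k + j * k₂ ≤ Q) qu≡0 qv≡1 Q≥)
        regroup : ∀ D m → 1 + (D + 2 * m) ≡ D + 1 + 2 * m
        regroup = solve-∀

      -- If `k ≤ k₂`, the larger value `q v` falls on the larger part of `T`, and Chebyshev's sum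
      -- inequality gives `P t ≤ 2 Q`. Hence `k₂ < k`, and `t < 2 k` with `k ≤ q u + 1`.
      t-if-heavy : ¬ (P * t ≤ 2 * Q) → t ≤ 2 * q u + 1
      t-if-heavy heavy with ℕ.≤-<-connex k k₂
      ... | inj₁ k≤k₂ = ⊥-elim (heavy (ℕ.≤-trans (ℕ.≤-reflexive (cong (P *_) t≡k+k₂))
              (ℕ.≤-trans (average qu≤qv k≤k₂) (ℕ.*-monoʳ-≤ 2 Q≥))))
        where
        average : ∀ {i j k k₂} → i ≤ j → k ≤ k₂ → (i + j) * (k + k₂) ≤ 2 * (i * k + j * k₂)
        average {i} {k = k} i≤j k≤k₂ with x , refl ← ℕ.m≤n⇒∃[o]m+o≡n i≤j | y , refl ← ℕ.m≤n⇒∃[o]m+o≡n k≤k₂ =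
          ℕ.≤-trans (ℕ.m≤m+n _ (x * y)) (ℕ.≤-reflexive (identity i x k y))
          where
          identity : ∀ i x k y → (i + (i + x)) * (k + (k + y)) + x * y ≡ 2 * (i * k + (i + x) * (k + y))
          identity = solve-∀
      ... | inj₂ k₂<k = ℕ.≤-pred (begin-strict
        t                   ≡⟨ t≡k+k₂ ⟩
        k + k₂              <⟨ ℕ.+-monoʳ-< k k₂<k ⟩
        k + k               ≤⟨ ℕ.+-mono-≤ k≤ k≤ ⟩
        q u + 1 + (q u + 1) ≡⟨ regroup (q u) ⟩
        suc (2 * q u + 1)   ∎)
        where
        open ℕ.≤-Reasoning
        regroup : ∀ i → i + 1 + (i + 1) ≡ suc (2 * i + 1)
        regroup = solve-∀

      -- `P = 0` contradicts `F₂` at once. `P = 1` is separated because the light case relies on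
      -- `P ≥ 2`.
      contradiction-by-P : ∀ p → P ≡ p → ⊥
      contradiction-by-P zero P≡0 = ℕ.m+1+n≰m 0
        (ℕ.≤-trans (ℕ.m≤n+m 2 (2 * D)) (subst (λ p → 2 * D + 2 ≤ p * A) P≡0 F₂))
      contradiction-by-P (suc zero) P≡1 = unit-pair-absurd {c} {B} {A} {A′} {m} {t} {D} 2≤c 2≤B A≡B+c A′+2≡B+c (t-if-one P≡1)
        (subst (λ p → 2 * D + 2 ≤ p * A) P≡1 F₂)
        (subst (λ p → 2 * D + 2 + 2 * B * (A′ + 2 * m) < 2 * B * t + c * p) P≡1 F₁)
      contradiction-by-P (suc (suc p)) P≡ with P * t ℕ.≤? 2 * Q
      ... | yes light = light-pair-absurd {c} {B} {A} {A′} {m} {t} {D} {Q} {P} 2≤c A≡B+c A′+2≡B+c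
              (subst (2 ≤_) (sym P≡) (s≤s (s≤s z≤n))) light Q≤D+2m Q<Bt F₂ F₁
      ... | no heavy = heavy-pair-absurd {b} {c} {B} {A′} {m} {t} {D} {Q} {q u} {q v} 2≤c c≤b A′+2≡B+c b<t (t-if-heavy heavy)
              q<B (ℕ.+-mono-<-≤ (d<B v Tv) (e≤m v)) qt≤Q Q≤D+2m F₁

  absurd : ⊥
  absurd with argmin T q
  -- `T` is nonempty because `b < t`.
  ... | inj₁ none = ℕ.n≮0 (subst (b <_) (count-none T none) b<t)
  ... | inj₂ (u , Tu , u-least) with argmin (MinimalVertex.W u Tu u-least) q
  ... | inj₁ none = MinimalVertex.T-not-clique u Tu u-least none
  ... | inj₂ (v , Wv , v-least) = contradiction-by-P _ refl
    where open MinimalVertex.Pair u Tu u-least v Wv v-least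

theorem3 : (n : ℕ) (G : Graph n) (b a n' m Δ : ℕ) (g f : Fin n → ℕ) →
    2 ≤ a → a + Δ ≤ b →
    (∀ x → b * (b ∸ Δ) + (m + n') * (Δ + a) ≤ deg G x * (Δ + a)) →
    (b + a + 2 * m ∸ 2) * (a + b) + n' * (Δ + a) < n * (Δ + a) →
    (∀ x → (f x ≤ b) × (g x + Δ ≤ f x) × (a ≤ g x)) →
    (∀ u v → u ≢ v → adj G u v ≡ false →
      2 * (n * (b ∸ Δ) + n' * (Δ + a)) ≤ (deg G u + deg G v) * (b + a)) →
    FractionalCriticalDeleted G g f n' m
theorem3 n G b a n' m Δ g f 2≤a a+Δ≤b min-deg order bounds ore U ∣U∣≡n' H H-sym H⊆ ∣H∣≡m =
  [ id , ⊥-elim ∘ Contradiction.absurd G b a n' m Δ g f 2≤a a+Δ≤b min-deg order bounds ore U ∣U∣≡n' H H-sym H⊆ ∣H∣≡m ]′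
    (factor-or-obstruction E-sym E⊆V (λ x → ℕ.≤-trans (ℕ.m≤m+n (g x) Δ) (proj₁ (proj₂ (bounds x)))))
  where
  E-sym : ∀ x y → edgesMinus G U x y ∧ not (H x y) ≡ edgesMinus G U y x ∧ not (H y x)
  E-sym x y rewrite adj-sym G x y | ∧-comm (outside U x) (outside U y) | H-sym x y = refl
  E⊆V : ∀ x y → edgesMinus G U x y ∧ not (H x y) ≡ true → outside U y ≡ true
  E⊆V x y Exy = proj₂ (∧-true {outside U x} (proj₂ (∧-true {adj G x y} (proj₁ (∧-true Exy)))))
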